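{- Let $\Lambda\in\{\mathrm{K},\mathrm{GL}\}$, let $\vec r=\langle r_0,\dots,r_{n-1}\rangle$ be a finite tuple of parameters and let $\varphi\in\mathrm{Fm}(p,\vec r)$. Then $\varphi$ is normal additive in $\Lambda$ (with respect to $p$) if and only if $\varphi$ is $\Lambda$-equivalent to a (finite, possibly empty) disjunction of $\delta$-formulas.
   Context: Modal formulas are built from propositional variables using Boolean connectives, $\bot$, $\top$, $\Diamond$ and $\Box$. The variables $p$ and $q$ are distinct non-parameter variables; parameters are variables distinct from $p$ and $q$. $\mathrm{Fm}(p,\vec r)$ is the set of modal formulas containing no variables other than $p,r_0,\dots,r_{n-1}$; $\mathrm{Fm}(\vec r)$ is the set of modal formulas containing no variables other than $r_0,\dots,r_{n-1}$. A $\delta$-formula is a formula of the form $\delta_{\vec\varkappa}=\varkappa_0\wedge\Diamond(\varkappa_1\wedge\dots\wedge\Diamond(\varkappa_m\wedge p)\dots)$ with $m\ge 0$ and $\varkappa_0,\dots,\varkappa_m\in\mathrm{Fm}(\vec r)$ (for $m=0$ it is $\varkappa_0\wedge p$). For a normal modal logic $\Lambda$, formulas $\varphi,\psi$ are $\Lambda$-equivalent if $\Lambda\vdash\varphi\leftrightarrow\psi$. A formula $\varphi(p,\vec r)$ is additive in $\Lambda$ if $\Lambda\vdash\varphi(p\vee q,\vec r)\leftrightarrow\varphi(p,\vec r)\vee\varphi(q,\vec r)$, normal in $\Lambda$ if $\Lambda\vdash\varphi(\bot,\vec r)\leftrightarrow\bot$, and normal additive if it is both. $\mathrm{K}$ is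 the least normal modal logic and $\mathrm{GL}$ is the G\"odel--L\"ob logic, $\mathrm{K}$ plus $\Box(\Box p\to p)\to\Box p$. An empty disjunction is $\bot$. -}

module Defs where

open import Data.Bool using (Bool; true; false; if_then_else_) renaming (_∧_ to _&&_; _∨_ to _||_; not to !_)
open import Data.List using (List; foldr)
open import Data.List.Relation.Unary.All using (All)
open import Data.Nat using (ℕ; suc; _≟_)
open import Data.Product using (_×_; ∃; ∃-syntax)
open import Data.Unit using (⊤)
open import Data.Vec using (Vec; []; _∷_)
open import Data.Vec.Membership.Propositional using (_∈_)
import Data.Vec.Relation.Unary.All as Vec
open import Level using (0ℓ)
open import Relation.Binary.PropositionalEquality using (_≡_)
open import Relation.Nullary.Decidable using (does)
open import Relation.Unary using (Pred; ∅; ｛_｝)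

Var : Set
Var = ℕ

infix  9 □_ ◇_ ¬ᶠ_
infixr 7 _∧_
infixr 6 _∨_
infixr 5 _⇒_
infix  4 _↔_

data Formula : Set where
  var         : Var → Formula
  ⊥ᶠ ⊤ᶠ       : Formula
  _∧_ _∨_ _⇒_ : Formula → Formula → Formula
  □_ ◇_       : Formula → Formula

¬ᶠ_ : Formula → Formula
¬ᶠ A = A ⇒ ⊥ᶠ

_↔_ : Formula → Formula → Formula
A ↔ B = (A ⇒ B) ∧ (B ⇒ A)

⋁ : List Formula → Formula
⋁ = foldr _∨_ ⊥ᶠ

Fm : ∀ {n} → Vec Var n → Pred Formula 0ℓ
Fm xs (var x) = x ∈ xs
Fm xs ⊥ᶠ      = ⊤
Fm xs ⊤ᶠ      = ⊤
Fm xs (A ∧ B) = Fm xs A × Fm xs B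
Fm xs (A ∨ B) = Fm xs A × Fm xs B
Fm xs (A ⇒ B) = Fm xs A × Fm xs B
Fm xs (□ A)   = Fm xs A
Fm xs (◇ A)   = Fm xs A

substitute : (Var → Formula) → Formula → Formula
substitute σ (var x) = σ x
substitute σ ⊥ᶠ      = ⊥ᶠ
substitute σ ⊤ᶠ      = ⊤ᶠ
substitute σ (A ∧ B) = substitute σ A ∧ substitute σ B
substitute σ (A ∨ B) = substitute σ A ∨ substitute σ B
substitute σ (A ⇒ B) = substitute σ A ⇒ substitute σ B
substitute σ (□ A)   = □ substitute σ A
substitute σ (◇ A)   = ◇ substitute σ A

infix 10 _[_↦_]

_[_↦_] : Formula → Var → Formula → Formula
A [ p ↦ B ] = substitute (λ x → if does (x ≟ p) then B else var x) A

-- Classical truth value of a formula whose variables and boxed or diamonded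
-- subformulas are all treated as independent propositional atoms.
eval : (Formula → Bool) → Formula → Bool
eval v (var x) = v (var x)
eval v ⊥ᶠ      = false
eval v ⊤ᶠ      = true
eval v (A ∧ B) = eval v A && eval v B
eval v (A ∨ B) = eval v A || eval v B
eval v (A ⇒ B) = (! eval v A) || eval v B
eval v (□ A)   = v (□ A)
eval v (◇ A)   = v (◇ A)

-- Equivalently, A is a substitution instance of a classical propositional tautology.
Tautology : Pred Formula 0ℓ
Tautology A = ∀ v → eval v A ≡ true

Logic : Set₁
Logic = Pred Formula 0ℓ

-- The least normal modal logic containing Γ. Since ◇ is primitive, its duality
-- with □ is an axiom.
data Normal⊕ (Γ : Pred Formula 0ℓ) : Logic where
  axiom : ∀ {A} → Γ A → Normal⊕ Γ A
  taut  : ∀ {A} → Tautology A → Normal⊕ Γ A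
  dist  : ∀ {A B} → Normal⊕ Γ (□ (A ⇒ B) ⇒ □ A ⇒ □ B)
  dual  : ∀ {A} → Normal⊕ Γ (◇ A ↔ ¬ᶠ □ ¬ᶠ A)
  mp    : ∀ {A B} → Normal⊕ Γ (A ⇒ B) → Normal⊕ Γ A → Normal⊕ Γ B
  nec   : ∀ {A} → Normal⊕ Γ A → Normal⊕ Γ (□ A)
  subst : ∀ {A} (σ : Var → Formula) → Normal⊕ Γ A → Normal⊕ Γ (substitute σ A)

K : Logic
K = Normal⊕ ∅

löb : Formula
löb = □ (□ var 0 ⇒ var 0) ⇒ □ var 0

GL : Logic
GL = Normal⊕ ｛ löb ｝

infix 3 _⊢_

_⊢_ : Logic → Formula → Set
Λ ⊢ A = Λ A

Equivalent : Logic → Formula → Formula → Set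
Equivalent Λ A B = Λ ⊢ A ↔ B

Additive : Logic → (p q : Var) → Formula → Set
Additive Λ p q φ = Λ ⊢ φ [ p ↦ var p ∨ var q ] ↔ φ ∨ φ [ p ↦ var q ]

Normal : Logic → (p : Var) → Formula → Set
Normal Λ p φ = Λ ⊢ φ [ p ↦ ⊥ᶠ ] ↔ ⊥ᶠ

NormalAdditive : Logic → (p q : Var) → Formula → Set
NormalAdditive Λ p q φ = Normal Λ p φ × Additive Λ p q φ

δ : Var → ∀ {m} → Vec Formula (suc m) → Formula
δ p (κ ∷ [])          = κ ∧ var p
δ p (κ ∷ κs@(_ ∷ _)) = κ ∧ ◇ δ p κs

IsδFormula : ∀ {n} → Var → Vec Var n → Pred Formula 0ℓ
IsδFormula p r ψ = ∃[ m ] ∃ λ (κs : Vec Formula (suc m)) → Vec.All (Fm r) κs × ψ ≡ δ p κs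

IsδDisjunction : ∀ {n} → Var → Vec Var n → Pred Formula 0ℓ
IsδDisjunction p r ψ = ∃ λ (ψs : List Formula) → All (IsδFormula p r) ψs × ψ ≡ ⋁ ψs

{-# OPTIONS --safe #-}

-- K and GL are complete for finite trees, so equivalences may be checked on trees. Call the worlds
-- where p holds marked. Duplicate the children of every world of a tree; the marks can then be
-- separated one by one, and additivity and normality show that φ holds at the root iff it holds for a
-- single mark at some world x, where every world on the path from the root to x also sees unmarked
-- copies of all it sees in the original tree. On such a tree the value of φ at a world of the path
-- depends only on the parameters and on which arguments of modalities become reachable through the next
-- world of the path; this is a finite amount of information, so "φ holds with a single mark" is a
-- disjunction of δ-formulas describing the path. In K the path is no longer than the modal depth of φ,
-- since otherwise the mark is invisible and normality is violated. In GL the set of reachable arguments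
-- only grows towards the root, and steps that do not change it can be skipped.

module Submission where

open import Data.Bool using (Bool; true; false; if_then_else_) renaming (_∧_ to _&&_; _∨_ to _||_; not to !_)
open import Data.Bool.Properties using (∨-identityʳ; ∨-idem; ∨-assoc; ∨-comm; ∨-zeroʳ; not-involutive; if-float)
open import Data.Empty using (⊥-elim)
open import Data.List using (List; []; _∷_; _++_; map; concatMap; foldr; length; replicate)
open import Data.List.Membership.Propositional using (lose; find) renaming (_∈_ to _∈ᴸ_)
open import Data.List.Membership.Propositional.Properties
  using (∈-map⁺; ∈-map⁻; ∈-++⁺ˡ; ∈-++⁺ʳ; ∈-++⁻; ∈-concatMap⁺; ∈-concatMap⁻)
import Data.List.Relation.Unary.All as All
open import Data.List.Relation.Unary.All using ([]; _∷_) renaming (All to Allᴸ)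
import Data.List.Relation.Unary.All.Properties as All
open import Data.List.Relation.Unary.Any using (here; there)
open import Data.Nat using (ℕ; zero; suc; _≟_; _+_; _⊔_; _≤_; _<_; z≤n; s≤s)
open import Data.Nat.Properties using (≤-refl; ≤-trans; <-≤-trans; m≤m⊔n; m≤n⊔m; n<1+n; m≤n⇒m≤1+n; ≤-pred)
open import Data.Product using (_×_; _,_; proj₁; proj₂; ∃; ∃-syntax)
open import Data.Sum using (_⊎_; inj₁; inj₂; [_,_]′)
open import Data.Unit using (⊤; tt)
open import Data.Vec using (Vec; []; _∷_; toList)
open import Data.Vec.Membership.Propositional using (_∈_)
open import Data.Vec.Relation.Unary.Any using (here; there)
open import Data.Vec.Membership.Propositional.Properties using (∈-toList⁺)
import Data.Vec.Relation.Unary.All as Vec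
open import Data.Vec.Relation.Unary.All using (All; []; _∷_)
open import Function using (_∘_; const; id)
open import Function.Bundles using (_⇔_; mk⇔)
open import Level using (0ℓ)
open import Relation.Binary using (DecidableEquality)
open import Relation.Binary.PropositionalEquality using (_≡_; _≢_; refl; sym; trans; cong; cong₂) renaming (subst to ≡-subst)
open import Relation.Nullary using (yes; no)
open import Relation.Nullary.Decidable using (does; map′; _×-dec_; dec-true; dec-false)
open import Relation.Unary using (Pred; ∅; ｛_｝)
open import Defs

-- The unmarked copies are what makes the coefficients free of `p`. At a path world, `◆ c` holds iff
-- the next path world reaches `c` or the erased children satisfy it; the first is a Boolean
-- recorded in a state, the second is `◇ (c [ p ↦ ⊥ᶠ ])`. Without a copy of the child on the path, a
-- coefficient evaluated at the parent would have to disregard that one child, which no formula can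
-- do. Completeness comes from a search: for each truth assignment to the variables and outermost
-- diamonds, either a tree realising it is built or its description is refuted in the logic. The
-- recursion is on nested modal arguments in K and on the number of true diamonds in GL. Both logics
-- are treated at once by the flag `transitive`.

private variable
  A B C : Formula
  v : Formula → Bool

-- Wrapping truth in a record lets Agda infer the formula.
infix 3 _⊩_
record _⊩_ (v : Formula → Bool) (A : Formula) : Set where
  constructor ⟨_⟩
  field holds : eval v A ≡ true
open _⊩_

-- Boolean and propositional reasoning

true-or-false : (b : Bool) → b ≡ true ⊎ b ≡ false
true-or-false true  = inj₁ refl
true-or-false false = inj₂ refl

true≢false : ∀ {b} → b ≡ true → b ≢ false
true≢false refl ()

true-ext : ∀ {a b} → (a ≡ true → b ≡ true) → (b ≡ true → a ≡ true) → a ≡ b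
true-ext {true}          f g = sym (f refl)
true-ext {false} {true}  f g = g refl
true-ext {false} {false} f g = refl

||-true⁻ : ∀ a {b} → a || b ≡ true → a ≡ true ⊎ b ≡ true
||-true⁻ true  h = inj₁ refl
||-true⁻ false h = inj₂ h

||-trueˡ : ∀ {a} b → a ≡ true → a || b ≡ true
||-trueˡ b refl = refl

||-trueʳ : ∀ a {b} → b ≡ true → a || b ≡ true
||-trueʳ a refl = ∨-zeroʳ a

⇒-intro : (v ⊩ A → v ⊩ B) → v ⊩ A ⇒ B
⇒-intro {v} {A} f with eval v A in eq
... | true  = ⟨ trans (cong (λ a → (! a) || _) eq) (holds (f ⟨ eq ⟩)) ⟩
... | false = ⟨ cong (λ a → (! a) || _) eq ⟩

⇒-elim : v ⊩ A ⇒ B → v ⊩ A → v ⊩ B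
⇒-elim {B = B} ⟨ f ⟩ ⟨ a ⟩ = ⟨ trans (sym (cong (λ a → (! a) || _) a)) f ⟩

⊥-absurd : ∀ {X : Set} → v ⊩ ⊥ᶠ → X
⊥-absurd ⟨ () ⟩

excluded-middle : ∀ v A → v ⊩ A ⊎ v ⊩ ¬ᶠ A
excluded-middle v A with eval v A in eq
... | true  = inj₁ ⟨ eq ⟩
... | false = inj₂ ⟨ cong (λ a → (! a) || false) eq ⟩

∧-intro : v ⊩ A → v ⊩ B → v ⊩ A ∧ B
∧-intro ⟨ a ⟩ ⟨ b ⟩ = ⟨ cong₂ _&&_ a b ⟩

∧-elim : v ⊩ A ∧ B → v ⊩ A × v ⊩ B
∧-elim {v} {A} {B} ⟨ h ⟩ with eval v A in eqA | eval v B in eqB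
... | true | true = ⟨ eqA ⟩ , ⟨ eqB ⟩

∨-introˡ : v ⊩ A → v ⊩ A ∨ B
∨-introˡ ⟨ a ⟩ = ⟨ ||-trueˡ _ a ⟩

∨-introʳ : v ⊩ B → v ⊩ A ∨ B
∨-introʳ ⟨ b ⟩ = ⟨ ||-trueʳ _ b ⟩

∨-elim : v ⊩ A ∨ B → v ⊩ A ⊎ v ⊩ B
∨-elim {v} {A} ⟨ h ⟩ with ||-true⁻ (eval v A) h
... | inj₁ a = inj₁ ⟨ a ⟩
... | inj₂ b = inj₂ ⟨ b ⟩

↔-intro : eval v A ≡ eval v B → v ⊩ A ↔ B
↔-intro eq = ∧-intro (⇒-intro λ a → ⟨ trans (sym eq) (holds a) ⟩) (⇒-intro λ b → ⟨ trans eq (holds b) ⟩)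

↔-elim : v ⊩ A ↔ B → eval v A ≡ eval v B
↔-elim h with ∧-elim h
... | f , g = true-ext (λ a → holds (⇒-elim f ⟨ a ⟩)) (λ b → holds (⇒-elim g ⟨ b ⟩))

-- Derivations in a normal modal logic

module Derivations (Γ : Pred Formula 0ℓ) where

  Λ : Logic
  Λ = Normal⊕ Γ

  private variable As : List Formula

  -- The implication from all of `As` to `B` is a tautology, and modus ponens discharges its
  -- premises. Derivations are thereby reduced to choosing the modal premises and arguing about one
  -- classical valuation.
  consequence : Allᴸ (Λ ⊢_) As → (∀ {v} → Allᴸ (v ⊩_) As → v ⊩ B) → Λ ⊢ B
  consequence {As = As} {B = B} ds h = detach As ds (taut λ v → holds (chain As h))
    where
    chain : ∀ As {v} → (Allᴸ (v ⊩_) As → v ⊩ B) → v ⊩ foldr _⇒_ B As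
    chain []       h = h []
    chain (A ∷ As) h = ⇒-intro λ a → chain As λ as → h (a ∷ as)
    detach : ∀ As → Allᴸ (Λ ⊢_) As → Λ ⊢ foldr _⇒_ B As → Λ ⊢ B
    detach []       []       d = d
    detach (A ∷ As) (a ∷ as) d = detach As as (mp d a)

  tautology : (∀ {v} → v ⊩ A) → Λ ⊢ A
  tautology h = taut λ v → holds h

  infer : Λ ⊢ A → (∀ {v} → v ⊩ A → v ⊩ B) → Λ ⊢ B
  infer d h = consequence (d ∷ []) λ { (a ∷ []) → h a }

  infer₂ : Λ ⊢ A → Λ ⊢ B → (∀ {v} → v ⊩ A → v ⊩ B → v ⊩ C) → Λ ⊢ C
  infer₂ d e h = consequence (d ∷ e ∷ []) λ { (a ∷ b ∷ []) → h a b }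

  ⇒-trans : Λ ⊢ A ⇒ B → Λ ⊢ B ⇒ C → Λ ⊢ A ⇒ C
  ⇒-trans d e = infer₂ d e λ f g → ⇒-intro λ a → ⇒-elim g (⇒-elim f a)

  ↔-of : Λ ⊢ A ⇒ B → Λ ⊢ B ⇒ A → Λ ⊢ A ↔ B
  ↔-of d e = infer₂ d e ∧-intro

  ↔-trans : Λ ⊢ A ↔ B → Λ ⊢ B ↔ C → Λ ⊢ A ↔ C
  ↔-trans d e = infer₂ d e λ a b → ↔-intro (trans (↔-elim a) (↔-elim b))

  ◇-mono : Λ ⊢ A ⇒ B → Λ ⊢ ◇ A ⇒ ◇ B
  ◇-mono {A} {B} d = consequence
    (mp dist (nec (infer d λ f → ⇒-intro λ nb → ⇒-intro λ a → ⇒-elim nb (⇒-elim f a))) ∷ dual {A = A} ∷ dual {A = B} ∷ [])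
    λ { {v} (f ∷ dA ∷ dB ∷ []) → ⇒-intro λ a → ⇒-elim (proj₂ (∧-elim dB))
          (⇒-intro λ b → ⇒-elim (⇒-elim (proj₁ (∧-elim dA)) a) (⇒-elim f b)) }

  ◇-cong : Λ ⊢ A ↔ B → Λ ⊢ ◇ A ↔ ◇ B
  ◇-cong d = ↔-of (◇-mono (infer d (proj₁ ∘ ∧-elim))) (◇-mono (infer d (proj₂ ∘ ∧-elim)))

  ◇-⊥ : Λ ⊢ ¬ᶠ ◇ ⊥ᶠ
  ◇-⊥ = infer₂ dual (nec (tautology (⇒-intro λ b → b))) λ d n → ⇒-intro λ a → ⇒-elim (⇒-elim (proj₁ (∧-elim d)) a) n

  ◇-∨ : Λ ⊢ ◇ (A ∨ B) ⇒ ◇ A ∨ ◇ B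
  ◇-∨ {A} {B} = consequence
    (nec {A = ¬ᶠ A ⇒ ¬ᶠ B ⇒ ¬ᶠ (A ∨ B)} (tautology (⇒-intro λ na → ⇒-intro λ nb → ⇒-intro λ ab → case ab na nb)) ∷
      dist {A = ¬ᶠ A} ∷ dist {A = ¬ᶠ B} ∷ dual {A = A} ∷ dual {A = B} ∷ dual {A = A ∨ B} ∷ [])
    λ { {v} (n ∷ k₁ ∷ k₂ ∷ dA ∷ dB ∷ dAB ∷ []) → ⇒-intro λ ab → byCases {v} n k₁ k₂ dA dB (⇒-elim (proj₁ (∧-elim dAB)) ab) }
    where
    case : v ⊩ A ∨ B → v ⊩ ¬ᶠ A → v ⊩ ¬ᶠ B → v ⊩ ⊥ᶠ
    case ab na nb with ∨-elim ab
    ... | inj₁ a = ⇒-elim na a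
    ... | inj₂ b = ⇒-elim nb b
    byCases : ∀ {X Y} → v ⊩ X → v ⊩ X ⇒ □ ¬ᶠ A ⇒ Y → v ⊩ Y ⇒ □ ¬ᶠ B ⇒ □ ¬ᶠ (A ∨ B) →
              v ⊩ ◇ A ↔ ¬ᶠ □ ¬ᶠ A → v ⊩ ◇ B ↔ ¬ᶠ □ ¬ᶠ B → v ⊩ ¬ᶠ □ ¬ᶠ (A ∨ B) → v ⊩ ◇ A ∨ ◇ B
    byCases {v = v} n k₁ k₂ dA dB nab with excluded-middle v (□ ¬ᶠ A) | excluded-middle v (□ ¬ᶠ B)
    ... | inj₂ na | _       = ∨-introˡ (⇒-elim (proj₂ (∧-elim dA)) na)
    ... | inj₁ _  | inj₂ nb = ∨-introʳ (⇒-elim (proj₂ (∧-elim dB)) nb)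
    ... | inj₁ a  | inj₁ b  = ⊥-absurd (⇒-elim nab (⇒-elim (⇒-elim k₂ (⇒-elim (⇒-elim k₁ n) a)) b))

  ◇-⋁-elim : ∀ As → Λ ⊢ A ⇒ ⋁ As → Allᴸ (λ B → Λ ⊢ ◇ B ⇒ C) As → Λ ⊢ ◇ A ⇒ C
  ◇-⋁-elim {C = C} As d es = ⇒-trans (◇-mono d) (eliminate es)
    where
    eliminate : ∀ {As} → Allᴸ (λ B → Λ ⊢ ◇ B ⇒ C) As → Λ ⊢ ◇ ⋁ As ⇒ C
    eliminate []       = infer ◇-⊥ λ n → ⇒-intro λ b → ⊥-absurd (⇒-elim n b)
    eliminate (e ∷ es) = consequence (◇-∨ ∷ e ∷ eliminate es ∷ []) λ where
      (d ∷ f ∷ g ∷ []) → ⇒-intro λ a → [ ⇒-elim f , ⇒-elim g ]′ (∨-elim (⇒-elim d a))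

-- Finite tree models

Valuation : Set
Valuation = Var → Bool

data Tree : Set where
  node : Valuation → List Tree → Tree

label : Tree → Valuation
label (node v _) = v

children : Tree → List Tree
children (node _ ts) = ts

module _ (ℓ : Tree → Valuation) where

  -- `ℓ` receives the whole subtree and not only the old label, because the new value of a variable
  -- may be the truth of a modal formula there.
  relabel  : Tree → Tree
  relabels : List Tree → List Tree
  relabel (node v ts) = node (ℓ (node v ts)) (relabels ts)
  relabels []         = []
  relabels (t ∷ ts)   = relabel t ∷ relabels ts

base : Bool → Pred Formula 0ℓ
base false = ∅
base true  = ｛ löb ｝

-- The worlds seen from the root are its children when transitive is false (for K),
-- and all its proper descendants when it is true (for GL).
module Semantics (transitive : Bool) where

  open Derivations (base transitive) public

  private variable
    P Q : Tree → Bool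
    s t : Tree
    ts  : List Tree

  dia  : (Tree → Bool) → Tree → Bool
  dias : (Tree → Bool) → List Tree → Bool
  dia P (node v ts) = dias P ts
  dias P []         = false
  dias P (t ∷ ts)   = (P t || (transitive && dia P t)) || dias P ts

  reflexive-dia : (Tree → Bool) → Tree → Bool
  reflexive-dia P t = P t || (transitive && dia P t)

  sat : Formula → Tree → Bool
  sat (var x) t = label t x
  sat ⊥ᶠ      t = false
  sat ⊤ᶠ      t = true
  sat (A ∧ B) t = sat A t && sat B t
  sat (A ∨ B) t = sat A t || sat B t
  sat (A ⇒ B) t = (! sat A t) || sat B t
  sat (□ A)   t = ! dia (λ s → ! sat A s) t
  sat (◇ A)   t = dia (sat A) t

  infix 4 _◁_
  -- Accessibility by tests instead of paths. Assuming `reflexive-dia` of `P` at `s`, rather than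
  -- `P s` alone, makes `◁-trans` and `≋-seen` immediate.
  record _◁_ (s t : Tree) : Set where
    constructor sees
    field see : ∀ P → reflexive-dia P s ≡ true → dia P t ≡ true
  open _◁_ public

  dia⁻ : dia P t ≡ true → ∃[ s ] (s ◁ t × P s ≡ true)
  dia⁻ {P} {t} h = below t h
    where
    forest : ∀ ts → dias P ts ≡ true → ∃[ s ] ((∀ Q → reflexive-dia Q s ≡ true → dias Q ts ≡ true) × P s ≡ true)
    below  : ∀ t → dia P t ≡ true → ∃[ s ] (s ◁ t × P s ≡ true)
    below (node v ts) h = let s , s◁ts , Ps = forest ts h in s , sees s◁ts , Ps
    forest (t ∷ ts) h with ||-true⁻ (reflexive-dia P t) h
    ... | inj₂ h′ = let s , s◁ts , Ps = forest ts h′ in s , (λ Q q → ||-trueʳ (reflexive-dia Q t) (s◁ts Q q)) , Ps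
    ... | inj₁ h′ with ||-true⁻ (P t) h′
    ...   | inj₁ Pt = t , (λ Q q → ||-trueˡ _ q) , Pt
    ...   | inj₂ h″ with true-or-false transitive
    ...     | inj₁ eq = let s , s◁t , Ps = below t (trans (sym (cong (_&& dia P t) eq)) h″) in
                        s , (λ Q q → ||-trueˡ _ (||-trueʳ (Q t) (cong₂ _&&_ eq (see s◁t Q q)))) , Ps
    ...     | inj₂ eq = ⊥-elim (true≢false h″ (cong (_&& dia P t) eq))

  dia⁺ : s ◁ t → P s ≡ true → dia P t ≡ true
  dia⁺ {P = P} s◁t Ps = see s◁t P (||-trueˡ _ Ps)

  dia-mono : (∀ s → P s ≡ true → Q s ≡ true) → dia P t ≡ true → dia Q t ≡ true
  dia-mono {P} {t = t} f h with dia⁻ {P} {t} h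
  ... | s , s◁t , Ps = dia⁺ s◁t (f s Ps)

  dia-ext : (∀ s → P s ≡ Q s) → dia P t ≡ dia Q t
  dia-ext {P} {Q} {t} eq = true-ext
    (dia-mono {P} {Q} {t} λ s h → trans (sym (eq s)) h) (dia-mono {Q} {P} {t} λ s h → trans (eq s) h)

  dias-ext : (∀ s → P s ≡ Q s) → dias P ts ≡ dias Q ts
  dias-ext {ts = ts} = dia-ext {t = node (const false) ts}

  dia-false⁺ : (∀ {s} → s ◁ t → P s ≡ false) → dia P t ≡ false
  dia-false⁺ {t} {P} none with true-or-false (dia P t)
  ... | inj₂ h = h
  ... | inj₁ h = let s , s◁t , Ps = dia⁻ {P} {t} h in ⊥-elim (true≢false Ps (none s◁t))

  ◁-trans : ∀ {r} → transitive ≡ true → r ◁ s → s ◁ t → r ◁ t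
  ◁-trans {s} tr r◁s s◁t = sees λ P h → see s◁t P (||-trueʳ (P s) (cong₂ _&&_ tr (see r◁s P h)))

  -- Finiteness of the tree enters here: descending while `P` still holds further down ends at a
  -- last world with `P`. This is what validates Löb's axiom.
  dia-last : transitive ≡ true → ∀ t → dia P t ≡ true → dia (λ s → P s && ! dia P s) t ≡ true
  dia-last {P} refl (node v ts) h = forest ts h
    where
    forest : ∀ ts → dias P ts ≡ true → dias (λ s → P s && ! dia P s) ts ≡ true
    forest (t ∷ ts) h with ||-true⁻ (reflexive-dia P t) h
    ... | inj₂ h′ = ||-trueʳ (reflexive-dia _ t) (forest ts h′)
    ... | inj₁ h′ with true-or-false (dia P t)
    ...   | inj₁ d = ||-trueˡ _ (||-trueʳ (P t && _) (dia-last refl t d))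
    ...   | inj₂ d with ||-true⁻ (P t) h′
    ...     | inj₁ Pt = ||-trueˡ _ (||-trueˡ _ (cong₂ _&&_ Pt (cong !_ d)))
    ...     | inj₂ d′ = ⊥-elim (true≢false d′ d)

  dia-relabel : ∀ ℓ → (∀ s → P s ≡ Q (relabel ℓ s)) → ∀ t → dia P t ≡ dia Q (relabel ℓ t)
  dia-relabel {P} {Q} ℓ eq (node v ts) = forest ts
    where
    forest : ∀ ts → dias P ts ≡ dias Q (relabels ℓ ts)
    forest []       = refl
    forest (t ∷ ts) = cong₂ _||_ (cong₂ _||_ (eq t) (cong (transitive &&_) (dia-relabel ℓ eq t))) (forest ts)

  sat-substitute : ∀ ℓ σ → (∀ t x → sat (σ x) t ≡ ℓ t x) → ∀ A t → sat (substitute σ A) t ≡ sat A (relabel ℓ t)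
  sat-substitute ℓ σ eq = go
    where
    go : ∀ A t → sat (substitute σ A) t ≡ sat A (relabel ℓ t)
    go (var x) t@(node _ _) = eq t x
    go ⊥ᶠ      t = refl
    go ⊤ᶠ      t = refl
    go (A ∧ B) t = cong₂ _&&_ (go A t) (go B t)
    go (A ∨ B) t = cong₂ _||_ (go A t) (go B t)
    go (A ⇒ B) t = cong₂ (λ a b → (! a) || b) (go A t) (go B t)
    go (□ A)   t = cong !_ (dia-relabel ℓ (λ s → cong !_ (go A s)) t)
    go (◇ A)   t = dia-relabel ℓ (go A) t

  truth : Tree → Formula → Bool
  truth t A = sat A t

  eval-truth : ∀ t A → eval (truth t) A ≡ sat A t
  eval-truth t (var x) = refl
  eval-truth t ⊥ᶠ      = refl
  eval-truth t ⊤ᶠ      = refl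
  eval-truth t (A ∧ B) = cong₂ _&&_ (eval-truth t A) (eval-truth t B)
  eval-truth t (A ∨ B) = cong₂ _||_ (eval-truth t A) (eval-truth t B)
  eval-truth t (A ⇒ B) = cong₂ (λ a b → (! a) || b) (eval-truth t A) (eval-truth t B)
  eval-truth t (□ A)   = refl
  eval-truth t (◇ A)   = refl

  infix 3 _⊨_
  _⊨_ : Tree → Formula → Set
  t ⊨ A = truth t ⊩ A

  sat⇒⊨ : sat A t ≡ true → t ⊨ A
  sat⇒⊨ {A} {t} h = ⟨ trans (eval-truth t A) h ⟩

  ⊨⇒sat : t ⊨ A → sat A t ≡ true
  ⊨⇒sat {t} {A} ⟨ h ⟩ = trans (sym (eval-truth t A)) h

  ⊨-◇⁻ : t ⊨ ◇ A → ∃[ s ] (s ◁ t × s ⊨ A)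
  ⊨-◇⁻ {t} {A} ⟨ h ⟩ with dia⁻ {sat A} {t} h
  ... | s , s◁t , a = s , s◁t , sat⇒⊨ a

  ⊨-◇⁺ : s ◁ t → s ⊨ A → t ⊨ ◇ A
  ⊨-◇⁺ s◁t a = ⟨ dia⁺ s◁t (⊨⇒sat a) ⟩

  ⊨-□⁻ : t ⊨ □ A → s ◁ t → s ⊨ A
  ⊨-□⁻ {t} {A} {s} ⟨ h ⟩ s◁t with true-or-false (sat A s)
  ... | inj₁ a = sat⇒⊨ a
  ... | inj₂ a = ⊥-elim (true≢false h (cong !_ (dia⁺ {P = λ s → ! sat A s} s◁t (cong !_ a))))

  ⊨-□⁺ : (∀ {s} → s ◁ t → s ⊨ A) → t ⊨ □ A
  ⊨-□⁺ {t} h = ⟨ cong !_ (dia-false⁺ {t} λ s◁t → cong !_ (⊨⇒sat (h s◁t))) ⟩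

  ⊨-löb : transitive ≡ true → ∀ A → t ⊨ □ (□ A ⇒ A) → t ⊨ □ A
  ⊨-löb {t} tr A h with true-or-false (dia (λ s → ! sat A s) t)
  ... | inj₂ eq = ⟨ cong !_ eq ⟩
  -- A last world refuting `A` satisfies `□ A`, hence `A` by the premise.
  ... | inj₁ eq with dia⁻ {λ s → (! sat A s) && ! dia (λ s → ! sat A s) s} {t} (dia-last tr t eq)
  ...   | s , s◁t , c with sat A s in na | dia (λ s → ! sat A s) s in nd
  ...     | false | false = ⊥-elim (true≢false (⊨⇒sat (⇒-elim (⊨-□⁻ h s◁t) ⟨ cong !_ nd ⟩)) na)

  sound : Λ ⊢ A → ∀ t → t ⊨ A
  sound (axiom a) t = sound-axiom transitive refl a
    where
    sound-axiom : ∀ b → b ≡ transitive → base b A → t ⊨ A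
    sound-axiom true eq refl = ⇒-intro (⊨-löb (sym eq) (var 0))
  sound (taut h) t = ⟨ h (truth t) ⟩
  sound dist t = ⇒-intro λ f → ⇒-intro λ a → ⊨-□⁺ λ s◁t → ⇒-elim (⊨-□⁻ f s◁t) (⊨-□⁻ a s◁t)
  sound (dual {A}) t = ∧-intro
    (⇒-intro λ d → ⇒-intro λ n → let s , s◁t , a = ⊨-◇⁻ d in ⊥-absurd (⇒-elim (⊨-□⁻ n s◁t) a))
    (⇒-intro λ n → [ (λ d → d) , (λ nd → ⊥-absurd (⇒-elim n (⊨-□⁺ λ s◁t → ⇒-intro λ a → ⊥-absurd (⇒-elim nd (⊨-◇⁺ s◁t a))))) ]′
                     (excluded-middle (truth t) (◇ A)))
  sound (mp d e) t = ⇒-elim (sound d t) (sound e t)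
  sound (nec d) t = ⊨-□⁺ λ {s} _ → sound d s
  sound (subst {A} σ d) t = sat⇒⊨ (trans (sat-substitute (λ s x → sat (σ x) s) σ (λ _ _ → refl) A t) (⊨⇒sat (sound d _)))

-- Reduced syntax, states and their descriptions

infix  9 ◆_ ∼_
infixr 7 _⊓_
infixr 5 _⊃_

-- Four constructors keep the inductions and the listing of modal arguments short; `core-↔`
-- transports results back to `Formula`.
data Core : Set where
  var : Var → Core
  ⊥ᶜ  : Core
  _⊃_ : Core → Core → Core
  ◆_  : Core → Core

∼_ : Core → Core
∼ a = a ⊃ ⊥ᶜ

_⊓_ : Core → Core → Core
a ⊓ b = ∼ (a ⊃ ∼ b)

private variable
  a c   : Core
  as cs : List Core

⌜_⌝ : Core → Formula
⌜ var x ⌝ = var x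
⌜ ⊥ᶜ ⌝    = ⊥ᶠ
⌜ a ⊃ c ⌝ = ⌜ a ⌝ ⇒ ⌜ c ⌝
⌜ ◆ a ⌝   = ◇ ⌜ a ⌝

core : Formula → Core
core (var x) = var x
core ⊥ᶠ      = ⊥ᶜ
core ⊤ᶠ      = ∼ ⊥ᶜ
core (A ∧ B) = core A ⊓ core B
core (A ∨ B) = ∼ core A ⊃ core B
core (A ⇒ B) = core A ⊃ core B
core (□ A)   = ∼ ◆ ∼ core A
core (◇ A)   = ◆ core A

Fm-core : ∀ {n} {xs : Vec Var n} A → Fm xs A → Fm xs ⌜ core A ⌝
Fm-core (var x) h       = h
Fm-core ⊥ᶠ      h       = tt
Fm-core ⊤ᶠ      h       = tt , tt
Fm-core (A ∧ B) (h , k) = (Fm-core A h , Fm-core B k , tt) , tt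
Fm-core (A ∨ B) (h , k) = (Fm-core A h , tt) , Fm-core B k
Fm-core (A ⇒ B) (h , k) = Fm-core A h , Fm-core B k
Fm-core (□ A)   h       = (Fm-core A h , tt) , tt
Fm-core (◇ A)   h       = Fm-core A h

infix 4 _≟ᶜ_
_≟ᶜ_ : DecidableEquality Core
var x ≟ᶜ var y = map′ (cong var) (λ { refl → refl }) (x ≟ y)
var x ≟ᶜ ⊥ᶜ = no λ ()
var x ≟ᶜ (c ⊃ d) = no λ ()
var x ≟ᶜ ◆ c = no λ ()
⊥ᶜ ≟ᶜ var x = no λ ()
⊥ᶜ ≟ᶜ ⊥ᶜ = yes refl
⊥ᶜ ≟ᶜ (c ⊃ d) = no λ ()
⊥ᶜ ≟ᶜ ◆ c = no λ ()
(a ⊃ b) ≟ᶜ var x = no λ ()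
(a ⊃ b) ≟ᶜ ⊥ᶜ = no λ ()
(a ⊃ b) ≟ᶜ (c ⊃ d) = map′ (λ { (refl , refl) → refl }) (λ { refl → refl , refl }) ((a ≟ᶜ c) ×-dec (b ≟ᶜ d))
(a ⊃ b) ≟ᶜ ◆ c = no λ ()
◆ a ≟ᶜ var x = no λ ()
◆ a ≟ᶜ ⊥ᶜ = no λ ()
◆ a ≟ᶜ (c ⊃ d) = no λ ()
◆ a ≟ᶜ ◆ c = map′ (cong ◆_) (λ { refl → refl }) (a ≟ᶜ c)

State : Set
State = Core → Bool

update : State → Core → Bool → State
update u a b c = if does (c ≟ᶜ a) then b else u c

branch : Core → State → List State
branch a u = update u a true ∷ update u a false ∷ []

states : List Core → List State
states []       = const false ∷ []
states (a ∷ as) = concatMap (branch a) (states as)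

states-complete : ∀ as (u : State) → ∃[ w ] (w ∈ᴸ states as × (∀ {a} → a ∈ᴸ as → w a ≡ u a))
states-complete []       u = const false , here refl , λ ()
states-complete (a ∷ as) u with states-complete as u
... | w , w∈ , agree = update w a (u a) , ∈-concatMap⁺ (branch a) (lose w∈ (choose (u a))) , λ {c} → updated c
  where
  choose : ∀ b → update w a b ∈ᴸ branch a w
  choose true  = here refl
  choose false = there (here refl)
  updated : ∀ c → c ∈ᴸ a ∷ as → update w a (u a) c ≡ u c
  updated c c∈ with c ≟ᶜ a | c∈
  ... | yes refl | _        = refl
  ... | no c≢a   | here eq  = ⊥-elim (c≢a eq)
  ... | no c≢a   | there c∈ = agree c∈

evaluate : State → Core → Bool
evaluate u (var x) = u (var x)
evaluate u ⊥ᶜ      = false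
evaluate u (a ⊃ c) = (! evaluate u a) || evaluate u c
evaluate u (◆ a)   = u (◆ a)

-- Common interface of truth under a state, under a classical valuation, at a tree, and of `local`
-- formulas at a tree, so that `literals` and `agree` are proved once for all of them.
record Homomorphic (e : Core → Bool) : Set where
  field
    on-⊥ : e ⊥ᶜ ≡ false
    on-⊃ : ∀ a c → e (a ⊃ c) ≡ (! e a) || e c

  on-∼ : ∀ a → e (∼ a) ≡ ! e a
  on-∼ a = trans (on-⊃ a ⊥ᶜ) (trans (cong (! e a ||_) on-⊥) (∨-identityʳ (! e a)))

  ∼⁺ : e a ≡ false → e (∼ a) ≡ true
  ∼⁺ h = trans (on-∼ _) (cong !_ h)

  ∼⁻ : e (∼ a) ≡ true → e a ≡ false
  ∼⁻ {a} h = trans (sym (not-involutive (e a))) (cong !_ (trans (sym (on-∼ a)) h))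

  ⊓⁺ : ∀ a c → e a ≡ true → e c ≡ true → e (a ⊓ c) ≡ true
  ⊓⁺ a c h k = ∼⁺ (trans (on-⊃ a (∼ c)) (cong₂ (λ x y → (! x) || y) h (trans (on-∼ c) (cong !_ k))))

  ⊓⁻ : ∀ a c → e (a ⊓ c) ≡ true → e a ≡ true × e c ≡ true
  ⊓⁻ a c h = split (e a) (e c) (trans (sym (trans (on-⊃ a (∼ c)) (cong (! e a ||_) (on-∼ c)))) (∼⁻ h))
    where
    split : ∀ x y → (! x) || (! y) ≡ false → x ≡ true × y ≡ true
    split true true _ = refl , refl

open Homomorphic

homomorphic-evaluate : ∀ u → Homomorphic (evaluate u)
homomorphic-evaluate u = record { on-⊥ = refl ; on-⊃ = λ _ _ → refl }

homomorphic-eval : ∀ v → Homomorphic (eval v ∘ ⌜_⌝)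
homomorphic-eval v = record { on-⊥ = refl ; on-⊃ = λ _ _ → refl }

literals : (Core → Core) → State → List Core → Core
literals h u []       = ∼ ⊥ᶜ
literals h u (a ∷ as) = (if u a then h a else ∼ h a) ⊓ literals h u as

module _ {e} (hom : Homomorphic e) (h : Core → Core) (u : State) where

  literals⁺ : (∀ {a} → a ∈ᴸ as → u a ≡ e (h a)) → e (literals h u as) ≡ true
  literals⁺ {[]}     eq = ∼⁺ hom (on-⊥ hom)
  literals⁺ {a ∷ as} eq = ⊓⁺ hom _ (literals h u as) (literal (u a) (eq (here refl))) (literals⁺ (eq ∘ there))
    where
    literal : ∀ b → b ≡ e (h a) → e (if b then h a else ∼ h a) ≡ true
    literal true  eq = sym eq
    literal false eq = ∼⁺ hom (sym eq)

  literals⁻ : e (literals h u as) ≡ true → a ∈ᴸ as → u a ≡ e (h a)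
  literals⁻ {a ∷ as} t (here refl) = literal (u a) (proj₁ (⊓⁻ hom (if u a then h a else ∼ h a) (literals h u as) t))
    where
    literal : ∀ b → e (if b then h a else ∼ h a) ≡ true → b ≡ e (h a)
    literal true  eq = sym eq
    literal false eq = sym (∼⁻ hom eq)
  literals⁻ {a ∷ as} t (there a∈) = literals⁻ (proj₂ (⊓⁻ hom (if u a then h a else ∼ h a) (literals h u as) t)) a∈

module _ {n} (xs : Vec Var n) where

  -- Nothing is asked below a diamond: the values on `atoms as` already decide such a formula, which
  -- is `agree`.
  Over : List Core → Core → Set
  Over as (var x) = x ∈ xs
  Over as ⊥ᶜ      = ⊤
  Over as (a ⊃ c) = Over as a × Over as c
  Over as (◆ a)   = a ∈ᴸ as

  atoms : List Core → List Core
  atoms as = map var (toList xs) ++ map ◆_ as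

  module _ {d e} (homᵈ : Homomorphic d) (homᵉ : Homomorphic e) where

    agree : (∀ {a} → a ∈ᴸ atoms as → d a ≡ e a) → ∀ a → Over as a → d a ≡ e a
    agree eq (var x) x∈      = eq (∈-++⁺ˡ (∈-map⁺ var (∈-toList⁺ x∈)))
    agree eq ⊥ᶜ      _       = trans (on-⊥ homᵈ) (sym (on-⊥ homᵉ))
    agree eq (a ⊃ c) (h , k) = trans (on-⊃ homᵈ a c)
      (trans (cong₂ (λ x y → (! x) || y) (agree eq a h) (agree eq c k)) (sym (on-⊃ homᵉ a c)))
    agree {as = as} eq (◆ a) a∈ = eq (∈-++⁺ʳ (map var (toList xs)) (∈-map⁺ ◆_ a∈))

module _ {Γ : Pred Formula 0ℓ} where

  open Derivations Γ

  core-↔ : ∀ A → Λ ⊢ A ↔ ⌜ core A ⌝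
  core-↔ (var x) = tautology (↔-intro refl)
  core-↔ ⊥ᶠ      = tautology (↔-intro refl)
  core-↔ ⊤ᶠ      = tautology (↔-intro refl)
  core-↔ (A ∧ B) = infer₂ (core-↔ A) (core-↔ B) λ {v} a b →
    ↔-intro (trans (cong₂ _&&_ (↔-elim a) (↔-elim b)) (conjunction (eval v ⌜ core A ⌝) (eval v ⌜ core B ⌝)))
    where
    conjunction : ∀ x y → x && y ≡ (! ((! x) || ((! y) || false))) || false
    conjunction false y     = refl
    conjunction true  false = refl
    conjunction true  true  = refl
  core-↔ (A ∨ B) = infer₂ (core-↔ A) (core-↔ B) λ {v} a b →
    ↔-intro (trans (cong₂ _||_ (↔-elim a) (↔-elim b)) (disjunction (eval v ⌜ core A ⌝) (eval v ⌜ core B ⌝)))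
    where
    disjunction : ∀ x y → x || y ≡ (! ((! x) || false)) || y
    disjunction false y = refl
    disjunction true  y = refl
  core-↔ (A ⇒ B) = infer₂ (core-↔ A) (core-↔ B) λ a b → ↔-intro (cong₂ (λ x y → (! x) || y) (↔-elim a) (↔-elim b))
  core-↔ (◇ A)   = ◇-cong (core-↔ A)
  core-↔ (□ A)   = consequence (□-mono (infer (core-↔ A) to) ∷ □-mono (infer (core-↔ A) from) ∷ dual {A = ¬ᶠ ⌜ core A ⌝} ∷ [])
    λ { {v} (f ∷ g ∷ d ∷ []) → ∧-intro
      (⇒-intro λ a → ⇒-intro λ b → ⇒-elim (⇒-elim (proj₁ (∧-elim d)) b) (⇒-elim f a))
      (⇒-intro λ nb → [ ⇒-elim g , (λ n → ⊥-absurd (⇒-elim nb (⇒-elim (proj₂ (∧-elim d)) n))) ]′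
        (excluded-middle v (□ ¬ᶠ ¬ᶠ ⌜ core A ⌝))) }
    where
    □-mono : ∀ {A B} → Λ ⊢ A ⇒ B → Λ ⊢ □ A ⇒ □ B
    □-mono d = mp dist (nec d)
    to : ∀ {v B} → v ⊩ A ↔ B → v ⊩ A ⇒ ¬ᶠ ¬ᶠ B
    to h = ⇒-intro λ a → ⇒-intro λ nb → ⇒-elim nb (⇒-elim (proj₁ (∧-elim h)) a)
    from : ∀ {v B} → v ⊩ A ↔ B → v ⊩ ¬ᶠ ¬ᶠ B ⇒ A
    from {v} {B} h = ⇒-intro λ nnb → ⇒-elim (proj₂ (∧-elim h))
      ([ id , (λ nb → ⊥-absurd (⇒-elim nnb nb)) ]′ (excluded-middle v B))

-- Completeness

_⊆_ : List Core → List Core → Set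
as ⊆ cs = ∀ {a} → a ∈ᴸ as → a ∈ᴸ cs

modals : Core → List Core
modals (var x) = []
modals ⊥ᶜ      = []
modals (a ⊃ c) = modals a ++ modals c
modals (◆ a)   = a ∷ modals a

depth : Core → ℕ
depth (var x) = 0
depth ⊥ᶜ      = 0
depth (a ⊃ c) = depth a ⊔ depth c
depth (◆ a)   = suc (depth a)

modals-depth : ∀ a → c ∈ᴸ modals a → depth c < depth a
modals-depth (a ⊃ d) c∈ with ∈-++⁻ (modals a) c∈
... | inj₁ h = <-≤-trans (modals-depth a h) (m≤m⊔n _ _)
... | inj₂ h = <-≤-trans (modals-depth d h) (m≤n⊔m _ _)
modals-depth (◆ a) (here refl) = n<1+n _
modals-depth (◆ a) (there h)   = m≤n⇒m≤1+n (modals-depth a h)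

modals-trans : ∀ a → c ∈ᴸ modals a → modals c ⊆ modals a
modals-trans (a ⊃ d) c∈ with ∈-++⁻ (modals a) c∈
... | inj₁ c∈ = ∈-++⁺ˡ ∘ modals-trans a c∈
... | inj₂ c∈ = ∈-++⁺ʳ (modals a) ∘ modals-trans d c∈
modals-trans (◆ a) (here refl) = there
modals-trans (◆ a) (there c∈)  = there ∘ modals-trans a c∈

module _ {n} (xs : Vec Var n) where

  Over-literals : ∀ {h u} → (∀ {a} → a ∈ᴸ as → Over xs cs (h a)) → Over xs cs (literals h u as)
  Over-literals {[]}     over = tt , tt
  Over-literals {a ∷ as} {cs} {h} {u} over = (literal (u a) , (Over-literals {as} (over ∘ there) , tt)) , tt
    where
    literal : ∀ b → Over xs cs (if b then h a else ∼ h a)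
    literal true  = over (here refl)
    literal false = over (here refl) , tt

  modals-Fm : ∀ a → Fm xs ⌜ a ⌝ → c ∈ᴸ modals a → Fm xs ⌜ c ⌝
  modals-Fm (a ⊃ d) (h , k) c∈ with ∈-++⁻ (modals a) c∈
  ... | inj₁ c∈ = modals-Fm a h c∈
  ... | inj₂ c∈ = modals-Fm d k c∈
  modals-Fm (◆ a) h (here refl) = h
  modals-Fm (◆ a) h (there c∈)  = modals-Fm a h c∈

  Over-modals : ∀ a → Fm xs ⌜ a ⌝ → modals a ⊆ as → Over xs as a
  Over-modals (var x) h       sub = h
  Over-modals ⊥ᶜ      h       sub = tt
  Over-modals (a ⊃ c) (h , k) sub = Over-modals a h (sub ∘ ∈-++⁺ˡ) , Over-modals c k (sub ∘ ∈-++⁺ʳ (modals a))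
  Over-modals (◆ a)   h       sub = sub (here refl)

count : State → List Core → ℕ
count u []       = 0
count u (a ∷ as) = (if u a then 1 else 0) + count u as

count-mono : ∀ {u w} → (∀ {a} → a ∈ᴸ as → u a ≡ true → w a ≡ true) → count u as ≤ count w as
count-mono {[]}     f = z≤n
count-mono {a ∷ as} {u} {w} f with u a | w a | f (here refl)
... | true  | true  | _ = s≤s (count-mono (f ∘ there))
... | true  | false | g with () ← g refl
... | false | true  | _ = m≤n⇒m≤1+n (count-mono (f ∘ there))
... | false | false | _ = count-mono (f ∘ there)

count-strict : ∀ {u w} → (∀ {a} → a ∈ᴸ as → u a ≡ true → w a ≡ true) →
               c ∈ᴸ as → u c ≡ false → w c ≡ true → count u as < count w as
count-strict {c ∷ as} {u = u} {w} f (here refl) uc wc with u c | w c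
... | false | true = s≤s (count-mono (f ∘ there))
count-strict {a ∷ as} {u = u} {w} f (there c∈) uc wc with u a | w a | f (here refl)
... | true  | true  | _ = s≤s (count-strict (f ∘ there) c∈ uc wc)
... | true  | false | g with () ← g refl
... | false | true  | _ = m≤n⇒m≤1+n (count-strict (f ∘ there) c∈ uc wc)
... | false | false | _ = count-strict (f ∘ there) c∈ uc wc

first-or-all : ∀ {X Y : Set} {Z : Y → Set} ys → (∀ {y} → y ∈ᴸ ys → X ⊎ Z y) → X ⊎ Allᴸ Z ys
first-or-all []       f = inj₂ []
first-or-all (y ∷ ys) f with f (here refl) | first-or-all ys (f ∘ there)
... | inj₁ x | _       = inj₁ x
... | inj₂ z | inj₁ x  = inj₁ x
... | inj₂ z | inj₂ zs = inj₂ (z ∷ zs)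

⋁⁺ : ∀ {As} → A ∈ᴸ As → v ⊩ A → v ⊩ ⋁ As
⋁⁺ (here refl) h = ∨-introˡ h
⋁⁺ (there A∈)  h = ∨-introʳ (⋁⁺ A∈ h)

⋁⁻ : ∀ As → v ⊩ ⋁ As → ∃[ A ] (A ∈ᴸ As × v ⊩ A)
⋁⁻ []       h = ⊥-absurd h
⋁⁻ (A ∷ As) h with ∨-elim h
... | inj₁ a = A , here refl , a
... | inj₂ as = let B , B∈ , b = ⋁⁻ As as in B , there B∈ , b

-- A world satisfies ◆ a iff one of its children satisfies reach b a.
reach : Bool → Core → Core
reach false a = a
reach true  a = ∼ a ⊃ ◆ a

-- Löb's axiom lets a witness of `◆ a` be chosen last; the conjunct `∼ ◆ a` is what makes the search
-- for GL terminate.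
final : Bool → Core → Core
final false a = a
final true  a = a ⊓ ∼ ◆ a

module _ where

  open Derivations

  ◇-final : ∀ b a → Normal⊕ (base b) ⊢ ◇ ⌜ a ⌝ ⇒ ◇ ⌜ final b a ⌝
  ◇-final false a = tautology (base false) (⇒-intro id)
  ◇-final true  a = consequence (base true)
    -- Löb's axiom for the negation of `a`: if all seen worlds refute `a ⊓ ∼ ◆ a`, then at each of
    -- them the boxed negation of `a` implies the negation of `a`, so all of them refute `a`.
    (subst (const (¬ᶠ ⌜ a ⌝)) (axiom refl) ∷ mp dist (nec step) ∷ dual {A = ⌜ a ⌝} ∷ dual {A = ⌜ a ⊓ ∼ ◆ a ⌝} ∷ [])
    λ { {v} (l ∷ s ∷ d ∷ e ∷ []) → ⇒-intro λ h → ⇒-elim (proj₂ (∧-elim e))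
          (⇒-intro λ n → ⇒-elim (⇒-elim (proj₁ (∧-elim d)) h) (⇒-elim l (⇒-elim s n))) }
    where
    step : Normal⊕ (base true) ⊢ ¬ᶠ ⌜ a ⊓ ∼ ◆ a ⌝ ⇒ □ ¬ᶠ ⌜ a ⌝ ⇒ ¬ᶠ ⌜ a ⌝
    step = infer (base true) (dual {A = ⌜ a ⌝}) λ {v} d → ⇒-intro λ n → ⇒-intro λ b → ⇒-intro λ h →
      ⇒-elim n ⟨ ⊓⁺ (homomorphic-eval v) a (∼ ◆ a) (holds h)
        (holds {A = ⌜ ∼ ◆ a ⌝} (⇒-intro λ p → ⇒-elim (⇒-elim (proj₁ (∧-elim d)) p) b)) ⟩

  -- For GL this is transitivity, obtained from Löb: a last world with `reach true a` cannot satisfy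
  -- `◆ a`, since `◆ reach true a` would follow there by monotonicity; so it satisfies `a` itself.
  ◇-reach : ∀ b a → Normal⊕ (base b) ⊢ ◇ ⌜ reach b a ⌝ ⇒ ◇ ⌜ a ⌝
  ◇-reach false a = tautology (base false) (⇒-intro id)
  ◇-reach true  a = ⇒-trans (base true) (◇-final true (reach true a)) (◇-mono (base true)
    (infer (base true) (◇-mono (base true) weaken) λ {v} m → ⇒-intro λ h →
      select v m (⊓⁻ (homomorphic-eval v) (reach true a) (∼ ◆ reach true a) (holds h))))
    where
    weaken : Normal⊕ (base true) ⊢ ⌜ a ⌝ ⇒ ⌜ reach true a ⌝
    weaken = tautology (base true) (⇒-intro λ h → ⇒-intro λ n → ⊥-absurd (⇒-elim n h))
    select : ∀ v → v ⊩ ◇ ⌜ a ⌝ ⇒ ◇ ⌜ reach true a ⌝ →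
             eval v ⌜ reach true a ⌝ ≡ true × eval v ⌜ ∼ ◆ reach true a ⌝ ≡ true → v ⊩ ⌜ a ⌝
    select v m (r , n) with excluded-middle v ⌜ a ⌝
    ... | inj₁ h  = h
    ... | inj₂ na = ⊥-absurd (⇒-elim {A = ◇ ⌜ reach true a ⌝} ⟨ n ⟩ (⇒-elim m (⇒-elim {A = ¬ᶠ ⌜ a ⌝} ⟨ r ⟩ na)))

sat-reach : ∀ b a t → Semantics.sat b ⌜ reach b a ⌝ t ≡ Semantics.reflexive-dia b (Semantics.sat b ⌜ a ⌝) t
sat-reach false a t = sym (∨-identityʳ _)
sat-reach true  a t with Semantics.sat true ⌜ a ⌝ t
... | true  = refl
... | false = refl

module Completeness (transitive : Bool) {n} (xs : Vec Var n) where

  open Semantics transitive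

  infix 4 _↝_
  -- `as` are the modal arguments that matter at a world, `cs` those that matter at the worlds it
  -- sees. The condition is on `reach`, because in GL a seen world is also tested for `◆ a`.
  _↝_ : List Core → List Core → Set
  as ↝ cs = ∀ {a} → a ∈ᴸ as → Fm xs ⌜ a ⌝ × Over xs cs (reach transitive a)

  homomorphic-sat : ∀ t → Homomorphic (λ a → sat ⌜ a ⌝ t)
  homomorphic-sat t = record { on-⊥ = refl ; on-⊃ = λ _ _ → refl }

  diagram : State → List Core → Core
  diagram f as = literals id f (atoms xs as)

  Realises : State → List Core → Tree → Set
  Realises f as t = ∀ a → Over xs as a → sat ⌜ a ⌝ t ≡ evaluate f a

  Decided : Core → Set
  Decided a = Λ ⊢ ¬ᶠ ⌜ a ⌝ ⊎ ∃[ t ] (sat ⌜ a ⌝ t ≡ true)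

  Realised : State → List Core → Set
  Realised f as = Λ ⊢ ¬ᶠ ⌜ diagram f as ⌝ ⊎ ∃ (Realises f as)

  -- What a world seen from one in state `f` must refute; `⊥ᶜ` imposes no restriction when `◆ a` is
  -- true in `f`.
  bound : State → Core → Core
  bound f a = if f (◆ a) then ⊥ᶜ else reach transitive a

  evaluate-atom : ∀ f → a ∈ᴸ atoms xs as → evaluate f a ≡ f a
  evaluate-atom {as = as} f a∈ with ∈-++⁻ (map var (toList xs)) a∈
  ... | inj₁ h with ∈-map⁻ var h
  ...   | x , _ , refl = refl
  evaluate-atom f a∈ | inj₂ h with ∈-map⁻ ◆_ h
  ...   | c , _ , refl = refl

  -- A realised state that makes `a` true yields a tree. If all such states are refuted, so is `a`,
  -- since every valuation satisfies the diagram of some listed state.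
  decide : ∀ as a → Over xs as a → (∀ f → evaluate f a ≡ true → Realised f as) → Decided a
  decide as a over realise = conclude (first-or-all (states (atoms xs as)) λ {f} _ → per-state f)
    where
    agreement : ∀ {e} (hom : Homomorphic e) f → e (diagram f as) ≡ true → evaluate f a ≡ e a
    agreement {e} hom f d =
      agree xs (homomorphic-evaluate f) hom (λ {c} c∈ → trans (evaluate-atom f c∈) (literals⁻ hom id f d c∈)) a over
    per-state : ∀ f → ∃[ t ] (sat ⌜ a ⌝ t ≡ true) ⊎ Λ ⊢ ⌜ diagram f as ⌝ ⇒ ¬ᶠ ⌜ a ⌝
    per-state f with true-or-false (evaluate f a)
    ... | inj₂ fa = inj₂ (tautology λ {v} → ⇒-intro λ d → ⇒-intro λ h →
                          ⊥-elim (true≢false (trans (agreement (homomorphic-eval v) f (holds d)) (holds h)) fa))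
    ... | inj₁ fa with realise f fa
    ...   | inj₁ d       = inj₂ (infer d λ n → ⇒-intro λ h → ⊥-absurd (⇒-elim n h))
    ...   | inj₂ (t , r) = inj₁ (t , trans (r a over) fa)
    conclude : ∃[ t ] (sat ⌜ a ⌝ t ≡ true) ⊎
               Allᴸ (λ f → Λ ⊢ ⌜ diagram f as ⌝ ⇒ ¬ᶠ ⌜ a ⌝) (states (atoms xs as)) → Decided a
    conclude (inj₁ t)  = inj₂ t
    conclude (inj₂ ds) = inj₁ (consequence (All.map⁺ ds) λ {v} hs →
      let f , f∈ , eq = states-complete (atoms xs as) (eval v ∘ ⌜_⌝) in
      ⇒-elim (All.lookup (All.map⁻ hs) f∈) ⟨ literals⁺ (homomorphic-eval v) id f {atoms xs as} eq ⟩)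

  witness : State → List Core → Core → Core
  witness f as a = final transitive a ⊓ literals (bound f) (const false) as

  -- The tree is assembled from one witness per true diamond; the bounds keep each witness from
  -- making a false diamond true.
  extend : ∀ f as → (∀ {a} → a ∈ᴸ as → f (◆ a) ≡ true → Decided (witness f as a)) → Realised f as
  extend f as successor = conclude (first-or-all as λ {a} a∈ → per-modal a a∈ (true-or-false (f (◆ a))))
    where
    Small : Tree → Set
    Small s = ∀ {a} → a ∈ᴸ as → f (◆ a) ≡ false → reflexive-dia (sat ⌜ a ⌝) s ≡ false

    Witnessed : Core → Set
    Witnessed a = f (◆ a) ≡ true → ∃[ s ] (Small s × sat ⌜ a ⌝ s ≡ true)

    final-sat : ∀ b a s → sat ⌜ final b a ⌝ s ≡ true → sat ⌜ a ⌝ s ≡ true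
    final-sat false a s h = h
    final-sat true  a s h = proj₁ (⊓⁻ (homomorphic-sat s) a (∼ ◆ a) h)

    small : ∀ s → sat ⌜ literals (bound f) (const false) as ⌝ s ≡ true → Small s
    small s h {a} a∈ fa = trans (sym (sat-reach transitive a s))
      (trans (cong (λ b → sat ⌜ if b then ⊥ᶜ else reach transitive a ⌝ s) (sym fa))
             (sym (literals⁻ (homomorphic-sat s) (bound f) (const false) h a∈)))

    -- If the witness is refutable, `final transitive a` implies the disjunction of the bounds. From
    -- `◇ ⌜ a ⌝` one then gets a diamond of some bound, which is `◇ ⊥ᶠ` or, by `◇-reach`, yields a
    -- diamond that the diagram denies.
    refute : ∀ a → a ∈ᴸ as → f (◆ a) ≡ true → Λ ⊢ ¬ᶠ ⌜ witness f as a ⌝ → Λ ⊢ ¬ᶠ ⌜ diagram f as ⌝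
    refute a a∈ fa d = infer
      (⇒-trans (◇-final transitive a)
        (◇-⋁-elim (map (⌜_⌝ ∘ bound f) as) cover (All.map⁺ (All.tabulate λ {c} → excluded c))))
      λ {v} g → ⇒-intro λ h → ⇒-elim (⇒-elim g ⟨ trans (sym (diagram⁻ v h a∈)) fa ⟩) h
      where
      diagram⁻ : ∀ v → v ⊩ ⌜ diagram f as ⌝ → c ∈ᴸ as → f (◆ c) ≡ eval v ⌜ ◆ c ⌝
      diagram⁻ v h c∈ =
        literals⁻ (homomorphic-eval v) id f {atoms xs as} (holds h) (∈-++⁺ʳ (map var (toList xs)) (∈-map⁺ ◆_ c∈))
      cover : Λ ⊢ ⌜ final transitive a ⌝ ⇒ ⋁ (map (⌜_⌝ ∘ bound f) as)
      cover = infer d λ {v} n → ⇒-intro λ h →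
        [ id , (λ none → ⊥-absurd (⇒-elim n
          ⟨ ⊓⁺ (homomorphic-eval v) (final transitive a) (literals (bound f) (const false) as) (holds h)
          (literals⁺ (homomorphic-eval v) (bound f) (const false) {as} λ {c} c∈ →
            none-holds (eval v ⌜ bound f c ⌝) λ e → ⇒-elim none (⋁⁺ (∈-map⁺ (⌜_⌝ ∘ bound f) c∈) ⟨ e ⟩)) ⟩)) ]′
        (excluded-middle v (⋁ (map (⌜_⌝ ∘ bound f) as)))
        where
        none-holds : ∀ b {v} → (b ≡ true → v ⊩ ⊥ᶠ) → false ≡ b
        none-holds false g = refl
        none-holds true  g = ⊥-absurd (g refl)
      bound-≡ : ∀ v {b} → f (◆ c) ≡ b → eval v (◇ ⌜ if b then ⊥ᶜ else reach transitive c ⌝) ≡ eval v (◇ ⌜ bound f c ⌝)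
      bound-≡ v refl = refl
      excluded : ∀ c → c ∈ᴸ as → Λ ⊢ ◇ ⌜ bound f c ⌝ ⇒ ¬ᶠ ⌜ diagram f as ⌝
      excluded c c∈ with true-or-false (f (◆ c))
      ... | inj₁ fc = infer ◇-⊥ λ {v} n → ⇒-intro λ h → ⊥-absurd (⇒-elim n ⟨ trans (bound-≡ v fc) (holds h) ⟩)
      ... | inj₂ fc = infer (◇-reach transitive c) λ {v} g → ⇒-intro λ h → ⇒-intro λ e → ⊥-elim (true≢false
              (holds (⇒-elim g ⟨ trans (bound-≡ v fc) (holds h) ⟩))
              (trans (sym (diagram⁻ v e c∈)) fc))

    per-modal : ∀ a → a ∈ᴸ as → f (◆ a) ≡ true ⊎ f (◆ a) ≡ false → Λ ⊢ ¬ᶠ ⌜ diagram f as ⌝ ⊎ Witnessed a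
    per-modal a a∈ (inj₂ fa) = inj₂ λ fa′ → ⊥-elim (true≢false fa′ fa)
    per-modal a a∈ (inj₁ fa) with successor a∈ fa
    ... | inj₁ d       = inj₁ (refute a a∈ fa d)
    ... | inj₂ (s , h) = let g , k = ⊓⁻ (homomorphic-sat s) (final transitive a) (literals (bound f) (const false) as) h in
                         inj₂ λ _ → s , small s k , final-sat transitive a s g

    gather : ∀ {cs} → Allᴸ Witnessed cs →
             ∃[ ts ] (Allᴸ Small ts × (∀ {a} → a ∈ᴸ cs → f (◆ a) ≡ true → dias (sat ⌜ a ⌝) ts ≡ true))
    gather [] = [] , [] , λ ()
    gather {c ∷ cs} (w ∷ ws) with gather ws | true-or-false (f (◆ c))
    ... | ts , smalls , seen | inj₂ fc = ts , smalls , λ where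
      (here refl) fa → ⊥-elim (true≢false fa fc)
      (there a∈)  fa → seen a∈ fa
    ... | ts , smalls , seen | inj₁ fc = let s , s-small , sc = w fc in s ∷ ts , s-small ∷ smalls , λ where
      (here refl) fa → ||-trueˡ _ (||-trueˡ _ sc)
      {a} (there a∈)  fa → ||-trueʳ (reflexive-dia (sat ⌜ a ⌝) s) (seen a∈ fa)

    unseen : ∀ {ts} → Allᴸ Small ts → a ∈ᴸ as → f (◆ a) ≡ false → dias (sat ⌜ a ⌝) ts ≡ false
    unseen []       a∈ fa = refl
    unseen (s ∷ ss) a∈ fa = cong₂ _||_ (s a∈ fa) (unseen ss a∈ fa)

    conclude : Λ ⊢ ¬ᶠ ⌜ diagram f as ⌝ ⊎ Allᴸ Witnessed as → Realised f as
    conclude (inj₁ d)  = inj₁ d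
    conclude (inj₂ ws) with gather ws
    ... | ts , smalls , seen = inj₂ (t , agree xs (homomorphic-sat t) (homomorphic-evaluate f) on-atoms)
      where
      t : Tree
      t = node (f ∘ var) ts
      modal : ∀ c → c ∈ᴸ as → sat ⌜ ◆ c ⌝ t ≡ f (◆ c)
      modal c c∈ with true-or-false (f (◆ c))
      ... | inj₁ fc = trans (seen c∈ fc) (sym fc)
      ... | inj₂ fc = trans (unseen smalls c∈ fc) (sym fc)
      on-atoms : a ∈ᴸ atoms xs as → sat ⌜ a ⌝ t ≡ evaluate f a
      on-atoms a∈ with ∈-++⁻ (map var (toList xs)) a∈
      ... | inj₁ h with ∈-map⁻ var h
      ...   | x , _ , refl = refl
      on-atoms a∈ | inj₂ h with ∈-map⁻ ◆_ h
      ...   | c , c∈ , refl = modal c c∈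

  Over-witness : ∀ {f as cs} → as ↝ cs → a ∈ᴸ as → Over xs cs (witness f as a)
  Over-witness {f = f} {as} {cs} step a∈ =
    (Over-final transitive (proj₂ (step a∈)) , Over-literals xs {as = as} (λ {c} c∈ → Over-bound (f (◆ c)) c∈) , tt) , tt
    where
    Over-final : ∀ b → Over xs cs (reach b a) → Over xs cs (final b a)
    Over-final false h             = h
    Over-final true  ((h , _) , k) = (h , (k , tt) , tt) , tt
    Over-bound : ∀ b → c ∈ᴸ as → Over xs cs (if b then ⊥ᶜ else reach transitive c)
    Over-bound true  c∈ = tt
    Over-bound false c∈ = proj₂ (step c∈)

  -- Levels of modal arguments along a path. In K they must run out, as modal depth does; in GL a
  -- chain may stop anywhere, since there the length is controlled by counting reachable arguments.
  data Chain : List Core → List (List Core) → Set where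
    [-] : (transitive ≡ false → as ≡ []) → Chain as []
    _∷_ : ∀ {css} → as ↝ cs → Chain cs css → Chain as (cs ∷ css)

  decide-along : transitive ≡ false → ∀ {css} → Chain as css → ∀ a → Over xs as a → Decided a
  decide-along K ([-] empty) a over with empty K
  ... | refl = decide [] a over λ f _ → extend f [] λ ()
  decide-along K (step ∷ chain) a over =
    decide _ a over λ f _ → extend f _ λ {c} c∈ _ →
      decide-along K chain (witness f _ c) (Over-witness {f = f} step c∈)

  -- By Löb, a true ◆ a is witnessed by a world where ◆ a fails, so the number of true diamonds drops.
  decide-closed : transitive ≡ true → as ↝ as → ∀ a → Over xs as a → Decided a
  decide-closed {as} refl closed a over = decide as a over λ f _ → realise _ f ≤-refl
    where
    realise : ∀ n f → count (f ∘ ◆_) as < n → Realised f as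
    realise (suc n) f (s≤s f≤n) = extend f as λ {c} c∈ fc →
      decide as (witness f as c) (Over-witness {f = f} closed c∈) λ g gc →
      let last , small = ⊓⁻ (homomorphic-evaluate g) (final true c) (literals (bound f) (const false) as) gc
          gc-false = ∼⁻ (homomorphic-evaluate g) {◆ c} (proj₂ (⊓⁻ (homomorphic-evaluate g) c (∼ ◆ c) last)) in
      realise n g (<-≤-trans (count-strict (λ {d} d∈ gd →
        drop f g d gd (literals⁻ (homomorphic-evaluate g) (bound f) (const false) small d∈)) c∈ gc-false fc) f≤n)
      where
      -- `◆ d` is a disjunct of `reach true d`, so if it were false in `f`, the bound would forbid
      -- it in `g`.
      drop : ∀ f g d → g (◆ d) ≡ true → false ≡ evaluate g (bound f d) → f (◆ d) ≡ true
      drop f g d gd h with f (◆ d)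
      ... | true  = refl
      ... | false = ⊥-elim (true≢false (||-trueʳ (! ((! evaluate g d) || false)) gd) (sym h))

  closed-modals : ∀ a → Fm xs ⌜ a ⌝ → modals a ↝ modals a
  closed-modals a h {c} c∈ = modals-Fm xs a h c∈ ,
    Over-reach transitive (Over-modals xs c (modals-Fm xs a h c∈) (modals-trans a c∈))
    where
    Over-reach : ∀ b → Over xs (modals a) c → Over xs (modals a) (reach b c)
    Over-reach false h = h
    Over-reach true  h = (h , tt) , c∈

  chain-exists : transitive ≡ false → ∀ n as →
                 (∀ {a} → a ∈ᴸ as → depth a < n) → (∀ {a} → a ∈ᴸ as → Fm xs ⌜ a ⌝) → ∃ (Chain as)
  chain-exists refl zero    []       shallow fm = [] , [-] λ _ → refl
  chain-exists refl zero    (a ∷ as) shallow fm with () ← shallow (here refl)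
  chain-exists refl (suc n) as       shallow fm =
    let css , chain = chain-exists refl n next
          (λ c∈ → let a , a∈ , c∈a = find (∈-concatMap⁻ modals {xs = as} c∈) in
                  <-≤-trans (modals-depth a c∈a) (≤-pred (shallow a∈)))
          (λ c∈ → let a , a∈ , c∈a = find (∈-concatMap⁻ modals {xs = as} c∈) in modals-Fm xs a (fm a∈) c∈a)
    in next ∷ css , (λ {a} a∈ → fm a∈ , Over-modals xs a (fm a∈) λ c∈ → ∈-concatMap⁺ modals (lose a∈ c∈)) ∷ chain
    where
    next : List Core
    next = concatMap modals as

  decidable : ∀ a → Fm xs ⌜ a ⌝ → Decided a
  decidable a h with true-or-false transitive
  ... | inj₁ eq = decide-closed eq (closed-modals a h) a (Over-modals xs a h id)
  ... | inj₂ eq = decide-along eq (proj₂ (chain-exists eq (suc (depth a)) (modals a)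
                    (λ c∈ → m≤n⇒m≤1+n (modals-depth a c∈)) (modals-Fm xs a h))) a (Over-modals xs a h id)

  complete : Fm xs A → (∀ t → t ⊨ A) → Λ ⊢ A
  complete {A} h valid with decidable (∼ core A) (Fm-core A h , tt)
  ... | inj₁ d = infer₂ d (core-↔ A) λ {v} n eq →
    [ ⇒-elim (proj₂ (∧-elim eq)) , (λ n′ → ⊥-absurd (⇒-elim n n′)) ]′ (excluded-middle v ⌜ core A ⌝)
  ... | inj₂ (t , n) = ⊥-absurd (⇒-elim (sat⇒⊨ {¬ᶠ ⌜ core A ⌝} n) (⇒-elim (proj₁ (∧-elim (sound (core-↔ A) t))) (valid t)))

-- Reducing the marks of a tree to a single one

module Equivalence (transitive : Bool) {n} (xs : Vec Var n) where

  open Semantics transitive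

  private variable
    s t u    : Tree
    ss ts us : List Tree
    f g      : Valuation

  infix 4 _≈_ _≋_
  -- Trees are compared only through formulas over `xs`, which cannot see the order or the
  -- repetition of children; this is what makes duplicating and absorbing children harmless.
  record _≈_ (s t : Tree) : Set where
    constructor same
    field sat-≡ : ∀ A → Fm xs A → sat A s ≡ sat A t
  open _≈_ public

  record _≋_ (ss ts : List Tree) : Set where
    constructor same
    field dias-≡ : ∀ A → Fm xs A → dias (sat A) ss ≡ dias (sat A) ts
  open _≋_ public

  ≈-refl : t ≈ t
  ≈-refl = same λ _ _ → refl

  ≋-refl : ts ≋ ts
  ≋-refl = same λ _ _ → refl

  ≋-trans : ss ≋ ts → ts ≋ us → ss ≋ us
  ≋-trans h k = same λ A a → trans (dias-≡ h A a) (dias-≡ k A a)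

  node-cong : (∀ {x} → x ∈ xs → f x ≡ g x) → ss ≋ ts → node f ss ≈ node g ts
  node-cong {f} {g} {ss} {ts} labels h = same go
    where
    go : ∀ A → Fm xs A → sat A (node f ss) ≡ sat A (node g ts)
    go (var x) x∈      = labels x∈
    go ⊥ᶠ      _       = refl
    go ⊤ᶠ      _       = refl
    go (A ∧ B) (a , b) = cong₂ _&&_ (go A a) (go B b)
    go (A ∨ B) (a , b) = cong₂ _||_ (go A a) (go B b)
    go (A ⇒ B) (a , b) = cong₂ (λ x y → (! x) || y) (go A a) (go B b)
    go (◇ A)   a       = dias-≡ h A a
    go (□ A)   a       = cong !_ (trans (dias-ext {ts = ss} λ s → sym (∨-identityʳ _))
      (trans (dias-≡ h (¬ᶠ A) (a , tt)) (dias-ext {ts = ts} λ s → ∨-identityʳ _)))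

  ∷-cong : s ≈ t → ss ≋ ts → s ∷ ss ≋ t ∷ ts
  ∷-cong h k = same λ A a →
    cong₂ _||_ (cong₂ _||_ (sat-≡ h A a) (cong (transitive &&_) (sat-≡ h (◇ A) a))) (dias-≡ k A a)

  dias-++ : ∀ P ss → dias P (ss ++ ts) ≡ dias P ss || dias P ts
  dias-++ P []       = refl
  dias-++ P (s ∷ ss) = trans (cong (reflexive-dia P s ||_) (dias-++ P ss)) (sym (∨-assoc (reflexive-dia P s) _ _))

  ++-idem : ∀ ts → ts ++ ts ≋ ts
  ++-idem ts = same λ A a → trans (dias-++ (sat A) ts) (∨-idem _)

  ++-comm : ∀ ss ts → ss ++ ts ≋ ts ++ ss
  ++-comm ss ts = same λ A a → trans (dias-++ (sat A) ss) (trans (∨-comm (dias (sat A) ss) _) (sym (dias-++ (sat A) ts)))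

  -- Being seen is enough: in GL, `s` may be a deep descendant that is added as a further child.
  ≋-seen : ∀ f → s ◁ node f ts → s ∷ ts ≋ ts
  ≋-seen {s} {ts} f s◁t = same λ A a → true-ext
    (λ h → [ see s◁t (sat A) , id ]′ (||-true⁻ (reflexive-dia (sat A) s) h)) (||-trueʳ (reflexive-dia (sat A) s))

  ◁-here : ∀ {f} → t ∈ᴸ ts → t ◁ node f ts
  ◁-here {t} (here refl)          = sees λ P h → ||-trueˡ _ h
  ◁-here {t} (there {x = s} t∈) = sees λ P h → ||-trueʳ (reflexive-dia P s) (see (◁-here {f = const false} t∈) P h)

  ++-absorb : (∀ {t} → t ∈ᴸ ss → t ∈ᴸ ts) → ss ++ ts ≋ ts
  ++-absorb {[]}     sub = ≋-refl
  ++-absorb {s ∷ ss} sub = ≋-trans (∷-cong ≈-refl (++-absorb (sub ∘ there))) (≋-seen (const false) (◁-here (sub (here refl))))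

if-true : ∀ {X : Set} {x y : X} {b} → b ≡ true → (if b then x else y) ≡ x
if-true refl = refl

if-false : ∀ {X : Set} {x y : X} {b} → b ≡ false → (if b then x else y) ≡ y
if-false refl = refl

≟-true : ∀ x → does (x ≟ x) ≡ true
≟-true x = dec-true (x ≟ x) refl

≟-false : ∀ {x y} → x ≢ y → does (x ≟ y) ≡ false
≟-false {x} {y} x≢y = dec-false (x ≟ y) x≢y

module Marking (transitive : Bool) {n} (p : Var) (r : Vec Var n) where

  open Semantics transitive
  open Equivalence transitive (p ∷ r) public

  private variable
    s t u    : Tree
    ss ts us : List Tree

  off : Tree → Valuation
  off t x = if does (x ≟ p) then false else label t x

  off-p : ∀ t → off t p ≡ false
  off-p t = cong (λ b → if b then false else label t p) (≟-true p)

  off-other : ∀ {x} → x ≢ p → off t x ≡ label t x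
  off-other {t} {x} x≢p = cong (λ b → if b then false else label t x) (≟-false x≢p)

  off-off : ∀ t x → off (node (off t) []) x ≡ off t x
  off-off t x with does (x ≟ p)
  ... | true  = refl
  ... | false = refl

  erase : Tree → Tree
  erase = relabel off

  erases : List Tree → List Tree
  erases = relabels off

  sat-erase : ∀ A t → sat (A [ p ↦ ⊥ᶠ ]) t ≡ sat A (erase t)
  sat-erase = sat-substitute off _ λ t x → if-sat (does (x ≟ p))
    where
    if-sat : ∀ b {t x} → sat (if b then ⊥ᶠ else var x) t ≡ (if b then false else label t x)
    if-sat true  = refl
    if-sat false = refl

  Unmarked : Tree → Set
  Unmarked t = erase t ≈ t

  erase-idem  : ∀ t → Unmarked (erase t)
  erases-idem : ∀ ts → erases (erases ts) ≋ erases ts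
  erase-idem (node f ts) = node-cong (λ {x} _ → off-off (node f ts) x) (erases-idem ts)
  erases-idem []         = ≋-refl
  erases-idem (t ∷ ts)   = ∷-cong (erase-idem t) (erases-idem ts)

  erases-∈ : t ∈ᴸ ts → erase t ∈ᴸ erases ts
  erases-∈ (here refl) = here refl
  erases-∈ (there t∈)  = there (erases-∈ t∈)

  -- The world t seeing the world s on the path to the marked world, besides an unmarked copy
  -- of everything it sees.
  onto : Tree → Tree → Tree
  onto t s = node (off t) (s ∷ erases (children t))

  onto-cong : ∀ t {s s′} → s ≈ s′ → onto t s ≈ onto t s′
  onto-cong t h = node-cong (λ _ → refl) (∷-cong h ≋-refl)

  onto-unmarked : ∀ t → Unmarked s → Unmarked (onto t s)
  onto-unmarked t h = node-cong (λ {x} _ → off-off t x) (∷-cong h (erases-idem (children t)))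

  -- A tree context listed from the hole upwards: the head of the list becomes the parent of the
  -- hole.
  plug : List Tree → Tree → Tree
  plug []      s = s
  plug (t ∷ k) s = plug k (onto t s)

  plug-cong : ∀ k {s s′} → s ≈ s′ → plug k s ≈ plug k s′
  plug-cong []      h = h
  plug-cong (t ∷ k) h = plug-cong k (onto-cong t h)

  plug-unmarked : ∀ k → Unmarked s → Unmarked (plug k s)
  plug-unmarked []      h = h
  plug-unmarked (t ∷ k) h = plug-unmarked k (onto-unmarked t h)

  record JoinLabels (f g h : Valuation) : Set where
    constructor joined
    field
      others : ∀ {x} → x ≢ p → f x ≡ h x × g x ≡ h x
      marks  : h p ≡ f p || g p

  -- Trees of one shape, the third carrying the marks of the other two together: the counterpart on
  -- trees of substituting `p ∨ q`.
  data Join  : Tree → Tree → Tree → Set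
  data Joins : List Tree → List Tree → List Tree → Set
  data Join where
    node : ∀ {f g h} → JoinLabels f g h → Joins ss ts us → Join (node f ss) (node g ts) (node h us)
  data Joins where
    []  : Joins [] [] []
    _∷_ : Join s t u → Joins ss ts us → Joins (s ∷ ss) (t ∷ ts) (u ∷ us)

  labels-idem : ∀ f → JoinLabels f f f
  labels-idem f = joined (λ _ → refl , refl) (sym (∨-idem (f p)))

  labels-keepˡ : ∀ f ts → JoinLabels f (off (node f ts)) f
  labels-keepˡ f ts = joined (λ x≢p → refl , off-other {node f ts} x≢p)
    (sym (trans (cong (f p ||_) (off-p (node f ts))) (∨-identityʳ (f p))))

  labels-keepʳ : ∀ f ts → JoinLabels (off (node f ts)) f f
  labels-keepʳ f ts = joined (λ x≢p → off-other {node f ts} x≢p , refl) (sym (cong (_|| f p) (off-p (node f ts))))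

  join-idem  : ∀ t → Join t t t
  joins-idem : ∀ ts → Joins ts ts ts
  join-idem (node f ts) = node (labels-idem f) (joins-idem ts)
  joins-idem []         = []
  joins-idem (t ∷ ts)   = join-idem t ∷ joins-idem ts

  join-keepˡ  : ∀ t → Join t (erase t) t
  joins-keepˡ : ∀ ts → Joins ts (erases ts) ts
  join-keepˡ (node f ts) = node (labels-keepˡ f ts) (joins-keepˡ ts)
  joins-keepˡ []         = []
  joins-keepˡ (t ∷ ts)   = join-keepˡ t ∷ joins-keepˡ ts

  join-keepʳ  : ∀ t → Join (erase t) t t
  joins-keepʳ : ∀ ts → Joins (erases ts) ts ts
  join-keepʳ (node f ts) = node (labels-keepʳ f ts) (joins-keepʳ ts)
  joins-keepʳ []         = []
  joins-keepʳ (t ∷ ts)   = join-keepʳ t ∷ joins-keepʳ ts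

  joins-++ : ∀ {ss′ ts′ us′} → Joins ss ts us → Joins ss′ ts′ us′ → Joins (ss ++ ss′) (ts ++ ts′) (us ++ us′)
  joins-++ []       js = js
  joins-++ (j ∷ is) js = j ∷ joins-++ is js

  join-plug : ∀ k → Join s t u → Join (plug k s) (plug k t) (plug k u)
  join-plug []      j = j
  join-plug (w ∷ k) j = join-plug k (node (labels-idem (off w)) (j ∷ joins-idem (erases (children w))))

  -- `step` goes to any seen world, so that in GL a path can follow the diamonds of a δ-formula and
  -- skip intermediate worlds.
  data Single : Tree → Tree → Set where
    stop : label t p ≡ true → Single t (node (label t) (erases (children t)))
    step : s ◁ t → Single s u → Single t (onto t u)

  module Splitting (φ : Formula)
    (normal : ∀ t → sat φ (erase t) ≡ false)
    (join : ∀ {s t u} → Join s t u → sat φ u ≡ sat φ s || sat φ t)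
    (fm : Fm (p ∷ r) φ) where

    unmarked-false : Unmarked t → sat φ t ≡ false
    unmarked-false {t} h = trans (sym (sat-≡ h φ fm)) (normal t)

    transport : s ≈ t → sat φ s ≡ true → sat φ t ≡ true
    transport h k = trans (sym (sat-≡ h φ fm)) k

    -- Duplicating all children makes room to separate the marks, one at a time, from the unmarked copy.
    split  : ∀ t k → sat φ (plug k t) ≡ true → ∃[ s ] (Single t s × sat φ (plug k s) ≡ true)
    splits : ∀ t k us → (∀ {u} → u ∈ᴸ us → u ∈ᴸ children t) →
             sat φ (plug k (node (off t) (us ++ erases (children t)))) ≡ true →
             ∃[ s ] (Single t s × sat φ (plug k s) ≡ true)
    split t@(node f ts) k h with ||-true⁻ (sat φ (plug k (node f (erases ts ++ erases ts))))
      (trans (sym (join (join-plug k (node (labels-keepˡ f ts) (joins-++ (joins-keepʳ ts) (joins-keepʳ ts))))))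
             (transport (plug-cong k (node-cong (λ _ → refl) (doubled ts))) h))
      where
      doubled : ∀ ts → ts ≋ ts ++ ts
      doubled ts = same λ A a → sym (dias-≡ (++-idem ts) A a)
    ... | inj₁ h′ = stopped (true-or-false (f p))
      where
      h″ : sat φ (plug k (node f (erases ts))) ≡ true
      h″ = transport (plug-cong k (node-cong (λ _ → refl) (++-idem (erases ts)))) h′
      off-≡ : f p ≡ false → ∀ x → off t x ≡ f x
      off-≡ fp x with x ≟ p
      ... | yes refl = trans (off-p t) (sym fp)
      ... | no x≢p   = off-other {t} x≢p
      stopped : f p ≡ true ⊎ f p ≡ false → ∃[ s ] (Single t s × sat φ (plug k s) ≡ true)
      stopped (inj₁ fp) = _ , stop fp , h″
      stopped (inj₂ fp) = ⊥-elim (true≢false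
        (transport (plug-cong k (node-cong (λ {x} _ → sym (off-≡ fp x)) ≋-refl)) h″)
        (unmarked-false (plug-unmarked k (erase-idem t))))
    -- The marks below the root now sit in both copies of the children. A second join leaves them in
    -- only one copy, the left one up to commutation.
    ... | inj₂ h′ = [ splits t k ts id ,
                      splits t k ts id ∘ transport (plug-cong k (node-cong (λ _ → refl) (++-comm (erases ts) ts))) ]′
      (||-true⁻ (sat φ (plug k (node (off t) (ts ++ erases ts))))
        (trans (sym (join (join-plug k (node (labels-idem (off t)) (joins-++ (joins-keepˡ ts) (joins-keepʳ ts)))))) h′))
    splits t k [] sub h = ⊥-elim (true≢false h (unmarked-false (plug-unmarked k
      (node-cong (λ {x} _ → off-off t x) (erases-idem (children t))))))
    -- The marks inside `u` are separated from those in `us`. In the first case the erased siblings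
    -- are absorbed by the unmarked copy, which leaves `onto t u`.
    splits t@(node f ts) k (u ∷ us) sub h with ||-true⁻ (sat φ (plug k (node (off t) (u ∷ erases us ++ erases ts))))
      (trans (sym (join (join-plug k (node (labels-idem (off t))
        (join-keepˡ u ∷ joins-++ (joins-keepʳ us) (joins-idem (erases ts))))))) h)
    ... | inj₁ h′ = let s , single , k′ = split u (t ∷ k)
                            (transport (plug-cong k (node-cong (λ _ → refl)
                              (∷-cong ≈-refl (++-absorb {erases us} (erased us (sub ∘ there)))))) h′) in
                    onto t s , step (◁-here (sub (here refl))) single , k′
      where
      erased : ∀ us → (∀ {u} → u ∈ᴸ us → u ∈ᴸ ts) → ∀ {u} → u ∈ᴸ erases us → u ∈ᴸ erases ts
      erased (u ∷ us) sub (here refl) = erases-∈ (sub (here refl))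
      erased (u ∷ us) sub (there u∈)  = erased us (sub ∘ there) u∈
    ... | inj₂ h′ = splits t k us (sub ∘ there) (transport (plug-cong k (node-cong (λ _ → refl) absorb)) h′)
      where
      absorb : erase u ∷ us ++ erases ts ≋ us ++ erases ts
      absorb = ≋-seen (const false) (◁-here (∈-++⁺ʳ us (erases-∈ (sub (here refl)))))

    -- The restored path world is put back as an additional child of `t`, redundant because its
    -- original is seen. `Join s w w` says that the marks of `s` are among those of `w`.
    restore : Single t s → ∃[ w ] (w ≈ t × Join s w w)
    restore {node f ts} (stop fp) = node f ts , ≈-refl , node (labels-idem f) (joins-keepʳ ts)
    restore {node f ts} (step s◁t single) with restore single
    ... | w , w≈s , j = node f (w ∷ ts) , node-cong (λ _ → refl) (≋-trans (∷-cong w≈s ≋-refl) (≋-seen f s◁t)) ,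
                        node (labels-keepʳ f ts) (j ∷ joins-keepʳ ts)

    -- Additivity makes `φ` monotone in the marks.
    single-sound : Single t s → sat φ s ≡ true → sat φ t ≡ true
    single-sound {s = s} single h with restore single
    ... | w , w≈t , j = transport w≈t (trans (join j) (||-trueˡ _ h))

    single-complete : sat φ t ≡ true → ∃[ s ] (Single t s × sat φ s ≡ true)
    single-complete {t} = split t []

-- δ-formulas describing the path to a single mark

count-≤-length : ∀ u as → count u as ≤ length as
count-≤-length u []       = z≤n
count-≤-length u (a ∷ as) with u a
... | true  = s≤s (count-≤-length u as)
... | false = m≤n⇒m≤1+n (count-≤-length u as)

Fm-weaken : ∀ {n x} {xs : Vec Var n} A → Fm xs A → Fm (x ∷ xs) A
Fm-weaken (var y) y∈      = there y∈
Fm-weaken ⊥ᶠ      h       = tt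
Fm-weaken ⊤ᶠ      h       = tt
Fm-weaken (A ∧ B) (h , k) = Fm-weaken A h , Fm-weaken B k
Fm-weaken (A ∨ B) (h , k) = Fm-weaken A h , Fm-weaken B k
Fm-weaken (A ⇒ B) (h , k) = Fm-weaken A h , Fm-weaken B k
Fm-weaken (□ A)   h       = Fm-weaken A h
Fm-weaken (◇ A)   h       = Fm-weaken A h

module Deltas (transitive : Bool) {n} (p : Var) (r : Vec Var n) where

  open Semantics transitive
  open Completeness transitive (p ∷ r)
  open Marking transitive p r

  private variable
    s t w : Tree
    css   : List (List Core)

  reached : Tree → State
  reached w a = reflexive-dia (sat ⌜ a ⌝) w

  -- The truth of `a` at a path world, rendered without `p`: `b` tells whether the world carries the
  -- mark, `u` what the next path world makes reachable, and the other diamonds are judged on the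
  -- unmarked copy.
  local : Bool → State → Core → Formula
  local b u (var x) = if does (x ≟ p) then (if b then ⊤ᶠ else ⊥ᶠ) else var x
  local b u ⊥ᶜ      = ⊥ᶠ
  local b u (a ⊃ c) = local b u a ⇒ local b u c
  local b u (◆ a)   = if u a then ⊤ᶠ else ◇ (⌜ a ⌝ [ p ↦ ⊥ᶠ ])

  local-modal : ∀ b u a t → sat (local b u (◆ a)) t ≡ u a || dias (sat ⌜ a ⌝) (erases (children t))
  local-modal b u a t@(node _ _) with u a
  ... | true  = refl
  ... | false = sat-erase (◇ ⌜ a ⌝) t

  homomorphic-local : ∀ b u t → Homomorphic (λ a → sat (local b u a) t)
  homomorphic-local b u t = record { on-⊥ = refl ; on-⊃ = λ _ _ → refl }

  sat-local : ∀ b u f ts → (∀ x → (if does (x ≟ p) then b else label t x) ≡ f x) →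
              (∀ {a} → a ∈ᴸ as → u a || dias (sat ⌜ a ⌝) (erases (children t)) ≡ dias (sat ⌜ a ⌝) ts) →
              ∀ a → Over (p ∷ r) as a → sat (local b u a) t ≡ sat ⌜ a ⌝ (node f ts)
  sat-local {t} {as} b u f ts labels modal = agree (p ∷ r) (homomorphic-local b u t) (homomorphic-sat (node f ts)) on-atoms
    where
    sat-var : ∀ c x → sat (if c then (if b then ⊤ᶠ else ⊥ᶠ) else var x) t ≡ (if c then b else label t x)
    sat-var false x = refl
    sat-var true  x = constant b
      where
      constant : ∀ b → sat (if b then ⊤ᶠ else ⊥ᶠ) t ≡ b
      constant true  = refl
      constant false = refl
    on-atoms : a ∈ᴸ atoms (p ∷ r) as → sat (local b u a) t ≡ sat ⌜ a ⌝ (node f ts)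
    on-atoms a∈ with ∈-++⁻ (map var (toList (p ∷ r))) a∈
    ... | inj₁ h with ∈-map⁻ var h
    ...   | x , _ , refl = trans (sat-var (does (x ≟ p)) x) (labels x)
    on-atoms a∈ | inj₂ h with ∈-map⁻ ◆_ h
    ...   | c , c∈ , refl = trans (local-modal b u c t) (modal c∈)

  sat-local-stop : label t p ≡ true → ∀ a → Over (p ∷ r) as a →
                   sat (local true (const false) a) t ≡ sat ⌜ a ⌝ (node (label t) (erases (children t)))
  sat-local-stop {t} {as} tp = sat-local {t} {as} true (const false) _ _ labels λ _ → refl
    where
    labels : ∀ x → (if does (x ≟ p) then true else label t x) ≡ label t x
    labels x with x ≟ p
    ... | yes refl = trans (if-true (≟-true p)) (sym tp)
    ... | no x≢p   = cong (λ b → if b then true else label t x) (≟-false x≢p)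

  sat-local-step : ∀ u → (∀ {a} → a ∈ᴸ as → u a ≡ reached w a) → ∀ a → Over (p ∷ r) as a →
                   sat (local false u a) t ≡ sat ⌜ a ⌝ (onto t w)
  sat-local-step {as} {w} {t} u eq = sat-local {t} {as} false u _ _ (λ _ → refl) λ {a} a∈ →
    cong (_|| dias (sat ⌜ a ⌝) (erases (children t))) (eq a∈)

  -- Passed down as the formula to be expressed at the next path world, so that the state guessed at
  -- one world is verified by the rest of the path.
  characteristic : State → List Core → Core
  characteristic u as = literals (reach transitive) u as

  characteristic⁺ : ∀ as {u} → (∀ {a} → a ∈ᴸ as → u a ≡ reached w a) → sat ⌜ characteristic u as ⌝ w ≡ true
  characteristic⁺ {w} as {u} eq = literals⁺ (homomorphic-sat w) (reach transitive) u {as} λ {a} a∈ →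
    trans (eq a∈) (sym (sat-reach transitive a w))

  characteristic⁻ : ∀ as {u} → sat ⌜ characteristic u as ⌝ w ≡ true → a ∈ᴸ as → u a ≡ reached w a
  characteristic⁻ {w} {a} as {u} h a∈ =
    trans (literals⁻ (homomorphic-sat w) (reach transitive) u {as} h a∈) (sat-reach transitive a w)

  Over-characteristic : ∀ {u} → as ↝ cs → Over (p ∷ r) cs (characteristic u as)
  Over-characteristic {as} link = Over-literals (p ∷ r) {as = as} (proj₂ ∘ link)

  onto-agree : (∀ {a} → a ∈ᴸ as → reached s a ≡ reached w a) → ∀ a → Over (p ∷ r) as a →
               sat ⌜ a ⌝ (onto t s) ≡ sat ⌜ a ⌝ (onto t w)
  onto-agree {as} {s} {w} {t} eq a over = trans
    (sym (sat-local-step {as} {s} {t} (reached s) (λ _ → refl) a over))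
    (sat-local-step {as} {w} {t} (reached s) eq a over)

  stopping : Core → Formula
  stopping a = local true (const false) a ∧ var p

  stepping : State → Core → Formula → Formula
  stepping u a d = local false u a ∧ ◇ d

  -- The disjunction says that a holds at t once the marks are reduced to a single one.
  -- State u records which arguments of modalities the next world on the path to the mark makes reachable.
  deltas : List Core → List (List Core) → Core → List Formula
  deltas as []         a = stopping a ∷ []
  deltas as (cs ∷ css) a = stopping a ∷
    concatMap (λ u → map (stepping u a) (deltas cs css (characteristic u as))) (states as)

  Expressed : List Core → List (List Core) → Core → Tree → Set
  Expressed as css a t = ∃[ d ] (d ∈ᴸ deltas as css a × sat d t ≡ true)

  expressed-sound : Chain as css → Over (p ∷ r) as a → Expressed as css a t → ∃[ s ] (Single t s × sat ⌜ a ⌝ s ≡ true)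
  expressed-sound {as} {css} {a} {t} chain over (d , d∈ , h) = cases chain d∈
    where
    stopped : sat (stopping a) t ≡ true → ∃[ s ] (Single t s × sat ⌜ a ⌝ s ≡ true)
    stopped h = let l , m = ∧-elim {A = local true (const false) a} {B = var p} (sat⇒⊨ h) in
      _ , stop (⊨⇒sat m) , trans (sym (sat-local-stop {as = as} (⊨⇒sat m) a over)) (⊨⇒sat l)
    cases : ∀ {css} → Chain as css → d ∈ᴸ deltas as css a → ∃[ s ] (Single t s × sat ⌜ a ⌝ s ≡ true)
    cases ([-] _)  (here refl) = stopped h
    cases (_ ∷ _)  (here refl) = stopped h
    cases {cs ∷ css} (link ∷ chain) (there d∈)
      with find (∈-concatMap⁻ (λ u → map (stepping u a) (deltas cs css (characteristic u as))) {xs = states as} d∈)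
    ... | u , _ , d∈ with ∈-map⁻ (stepping u a) d∈
    ...   | d′ , d′∈ , refl with ∧-elim {A = local false u a} {B = ◇ d′} (sat⇒⊨ h)
    ...     | l , m with ⊨-◇⁻ m
    ...       | s , s◁t , k with expressed-sound chain (Over-characteristic {as} link) (d′ , d′∈ , ⊨⇒sat k)
    ...         | w , single , c = onto t w , step s◁t single ,
                  trans (sym (sat-local-step {as} {w} {t} u (characteristic⁻ {w} as c) a over)) (⊨⇒sat l)

  stop-expressed : ∀ css → label t p ≡ true → Over (p ∷ r) as a →
                   sat ⌜ a ⌝ (node (label t) (erases (children t))) ≡ true → Expressed as css a t
  stop-expressed {t} {as} {a} css tp over h = stopping a , first css ,
    cong₂ _&&_ (trans (sat-local-stop {t} {as} tp a over) h) tp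
    where
    first : ∀ css → stopping a ∈ᴸ deltas as css a
    first []        = here refl
    first (_ ∷ css) = here refl

  step-expressed : s ◁ t → Over (p ∷ r) as a → sat ⌜ a ⌝ (onto t w) ≡ true →
                   ∀ {u} → u ∈ᴸ states as → (∀ {c} → c ∈ᴸ as → u c ≡ reached w c) →
                   Expressed cs css (characteristic u as) s → Expressed as (cs ∷ css) a t
  step-expressed {s} {t} {as} {a} {w} {cs} {css} s◁t over h {u} u∈ eq (d , d∈ , k) = stepping u a d ,
    there (∈-concatMap⁺ (λ u → map (stepping u a) (deltas cs css (characteristic u as))) (lose u∈ (∈-map⁺ (stepping u a) d∈))) ,
    cong₂ _&&_ (trans (sat-local-step {as} {w} {t} u eq a over) h) (dia⁺ s◁t k)

  ◁-erase : s ◁ t → erase s ◁ erase t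
  ◁-erase {s} {t} s◁t = sees λ P h → trans (sym (dia-relabel off (λ _ → refl) t))
    (see s◁t (P ∘ erase) (trans (cong (λ b → P (erase s) || (transitive && b)) (dia-relabel off (λ _ → refl) s)) h))

  -- A mark lying deeper than the modalities of a is invisible to a.
  expressed-or-invisible : transitive ≡ false → Chain as css → Over (p ∷ r) as a → Single t s → sat ⌜ a ⌝ s ≡ true →
                           Expressed as css a t ⊎ sat ⌜ a ⌝ (erase t) ≡ true
  expressed-or-invisible {as} {css} K chain over (stop tp) h = inj₁ (stop-expressed css tp over h)
  expressed-or-invisible {as} {css} {a} {t} K chain over (step {s} {u = w} s◁t single) h = cases chain
    where
    -- With respect to `as`, the world `w` merely duplicates `erase s`, which `erase t` sees
    -- already.
    invisible : (∀ {c} → c ∈ᴸ as → reached w c ≡ reached (erase s) c) → sat ⌜ a ⌝ (erase t) ≡ true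
    invisible eq = trans (sym (agree (p ∷ r) (homomorphic-sat (onto t w)) (homomorphic-sat (erase t)) on-atoms a over)) h
      where
      label-erase : ∀ t x → off t x ≡ label (erase t) x
      label-erase (node _ _) x = refl
      dias-erase : ∀ P t → dias P (erases (children t)) ≡ dia P (erase t)
      dias-erase P (node _ _) = refl
      on-atoms : ∀ {c} → c ∈ᴸ atoms (p ∷ r) as → sat ⌜ c ⌝ (onto t w) ≡ sat ⌜ c ⌝ (erase t)
      on-atoms c∈ with ∈-++⁻ (map var (toList (p ∷ r))) c∈
      ... | inj₁ k with ∈-map⁻ var k
      ...   | x , _ , refl = label-erase t x
      on-atoms c∈ | inj₂ k with ∈-map⁻ ◆_ k
      ...   | c , c∈ , refl = true-ext
        (λ k → [ (λ k → see (◁-erase s◁t) (sat ⌜ c ⌝) (trans (sym (eq c∈)) k)) , trans (sym (dias-erase (sat ⌜ c ⌝) t)) ]′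
                 (||-true⁻ (reached w c) k))
        (λ k → ||-trueʳ (reached w c) (trans (dias-erase (sat ⌜ c ⌝) t) k))
    cases : ∀ {css} → Chain as css → Expressed as css a t ⊎ sat ⌜ a ⌝ (erase t) ≡ true
    cases ([-] empty) with empty K
    ... | refl = inj₂ (invisible λ ())
    cases (link ∷ chain) with states-complete as (reached w)
    ... | u , u∈ , eq with expressed-or-invisible K chain (Over-characteristic {as} link) single (characteristic⁺ {w} as eq)
    ...   | inj₁ e = inj₁ (step-expressed s◁t over h u∈ eq e)
    -- The characteristic formula holds at `w` and at `erase s`, so both reach the same arguments.
    ...   | inj₂ k = inj₂ (invisible λ c∈ → trans (sym (eq c∈)) (characteristic⁻ {erase s} as k c∈))

  -- Steps of the path that do not change what is reachable are skipped, so the path is no longer than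
  -- the number of reachable arguments.
  step-expressed-closed : transitive ≡ true → as ↝ as → ∀ k → Over (p ∷ r) as a → s ◁ t → Single s w →
                          sat ⌜ a ⌝ (onto t w) ≡ true → count (reached w) as ≤ k → Expressed as (replicate (suc k) as) a t
  step-expressed-closed {as} {a} {s} GL closed k over s◁t (stop sp) h _
    with states-complete as (reached (node (label s) (erases (children s))))
  ... | u , u∈ , eq = step-expressed s◁t over h u∈ eq
    (stop-expressed (replicate k as) sp (Over-characteristic {as} closed) (characteristic⁺ as eq))
  step-expressed-closed {as} {a} {s} {t} GL closed k over s◁t (step {s′} {u = w} s′◁s single) h ≤k =
    cases (first-or-all as compare)
    where
    grows : ∀ c → reached w c ≡ true → reached (onto s w) c ≡ true
    grows c h = ||-trueʳ (sat ⌜ c ⌝ (onto s w)) (cong₂ _&&_ GL (||-trueˡ _ h))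
    Increase : Set
    Increase = ∃[ c ] (c ∈ᴸ as × reached w c ≡ false × reached (onto s w) c ≡ true)
    compare : ∀ {c} → c ∈ᴸ as → Increase ⊎ (reached w c ≡ reached (onto s w) c)
    compare {c} c∈ with true-or-false (reached w c) | true-or-false (reached (onto s w) c)
    ... | inj₁ h | _      = inj₂ (trans h (sym (grows c h)))
    ... | inj₂ h | inj₁ k = inj₁ (c , c∈ , h , k)
    ... | inj₂ h | inj₂ k = inj₂ (trans h (sym k))
    -- One level is spent on the step to `s`; the argument that becomes reachable only at `s` leaves
    -- the rest of the path with a smaller budget.
    strict : ∀ k → count (reached w) as < k → count (reached (onto s w)) as ≤ k → Expressed as (replicate (suc k) as) a t
    strict (suc k) (s≤s <k) ≤k with states-complete as (reached (onto s w))
    ... | u , u∈ , eq = step-expressed {cs = as} {css = replicate (suc k) as} s◁t over h u∈ eq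
      (step-expressed-closed GL closed k (Over-characteristic {as} closed) s′◁s single (characteristic⁺ as eq) <k)
    cases : Increase ⊎ Allᴸ (λ c → reached w c ≡ reached (onto s w) c) as → Expressed as (replicate (suc k) as) a t
    cases (inj₁ (c , c∈ , below , above)) =
      strict k (<-≤-trans (count-strict {w = reached (onto s w)} (λ {d} _ → grows d) c∈ below above) ≤k) ≤k
    -- `s` makes nothing new reachable, so `t` steps to `s′` directly, and `onto-agree` keeps `a`
    -- true.
    cases (inj₂ unchanged) = step-expressed-closed GL closed k over (◁-trans GL s′◁s s◁t) single
      (trans (onto-agree {as} {t = t} (All.lookup unchanged) a over) h)
      (≤-trans (count-mono {as} {w = reached (onto s w)} λ {d} _ → grows d) ≤k)

  -- At most `length as` arguments can become reachable along the path; the additional level pays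
  -- for the step into the marked world.
  expressed-closed : transitive ≡ true → as ↝ as → Over (p ∷ r) as a → Single t s → sat ⌜ a ⌝ s ≡ true →
                     Expressed as (replicate (suc (length as)) as) a t
  expressed-closed {as} GL closed over (stop tp) h = stop-expressed (replicate (suc (length as)) as) tp over h
  expressed-closed {as} GL closed over (step {u = w} s◁t single) h =
    step-expressed-closed GL closed (length as) over s◁t single h (count-≤-length (reached w) as)

  Fm-erase : ∀ a → Fm (p ∷ r) ⌜ a ⌝ → Fm r (⌜ a ⌝ [ p ↦ ⊥ᶠ ])
  Fm-erase (var x) x∈ with x ≟ p | x∈
  ... | yes refl | _        = ≡-subst (Fm r) (sym (if-true (≟-true p))) tt
  ... | no x≢p   | here x≡p = ⊥-elim (x≢p x≡p)
  ... | no x≢p   | there x∈ = ≡-subst (λ b → Fm r (if b then ⊥ᶠ else var x)) (sym (≟-false x≢p)) x∈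
  Fm-erase ⊥ᶜ      _       = tt
  Fm-erase (a ⊃ c) (h , k) = Fm-erase a h , Fm-erase c k
  Fm-erase (◆ a)   h       = Fm-erase a h

  Fm-local : ∀ b u a → Fm (p ∷ r) ⌜ a ⌝ → Fm r (local b u a)
  Fm-local b u (var x) x∈ with x ≟ p | x∈
  ... | yes refl | _        = ≡-subst (Fm r) (sym (if-true (≟-true p))) (constant b)
    where
    constant : ∀ b → Fm r (if b then ⊤ᶠ else ⊥ᶠ)
    constant true  = tt
    constant false = tt
  ... | no x≢p   | here x≡p = ⊥-elim (x≢p x≡p)
  ... | no x≢p   | there x∈ = ≡-subst (λ c → Fm r (if c then (if b then ⊤ᶠ else ⊥ᶠ) else var x)) (sym (≟-false x≢p)) x∈
  Fm-local b u ⊥ᶜ      _       = tt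
  Fm-local b u (a ⊃ c) (h , k) = Fm-local b u a h , Fm-local b u c k
  Fm-local b u (◆ a)   h with u a
  ... | true  = tt
  ... | false = Fm-erase a h

  Fm-characteristic : ∀ {u} as → (∀ {a} → a ∈ᴸ as → Fm (p ∷ r) ⌜ a ⌝) → Fm (p ∷ r) ⌜ characteristic u as ⌝
  Fm-characteristic []           fm = tt , tt
  Fm-characteristic {u} (a ∷ as) fm = (literal (u a) , Fm-characteristic as (fm ∘ there) , tt) , tt
    where
    Fm-reach : ∀ b → Fm (p ∷ r) ⌜ reach b a ⌝
    Fm-reach false = fm (here refl)
    Fm-reach true  = (fm (here refl) , tt) , fm (here refl)
    literal : ∀ b → Fm (p ∷ r) ⌜ if b then reach transitive a else ∼ reach transitive a ⌝
    literal true  = Fm-reach transitive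
    literal false = Fm-reach transitive , tt

  deltas-δ : Chain as css → Fm (p ∷ r) ⌜ a ⌝ → Allᴸ (IsδFormula p r) (deltas as css a)
  deltas-δ {as} {css} {a} chain fm = cases chain
    where
    stopping-δ : IsδFormula p r (stopping a)
    stopping-δ = 0 , local true (const false) a ∷ [] , Fm-local true (const false) a fm ∷ [] , refl
    stepping-δ : ∀ u {d} → IsδFormula p r d → IsδFormula p r (stepping u a d)
    stepping-δ u (m , κ ∷ κs , fms , refl) = suc m , local false u a ∷ κ ∷ κs , Fm-local false u a fm ∷ fms , refl
    cases : ∀ {css} → Chain as css → Allᴸ (IsδFormula p r) (deltas as css a)
    cases ([-] _)                  = stopping-δ ∷ []
    cases {cs ∷ css} (link ∷ chain) = stopping-δ ∷ All.concat⁺ (All.map⁺ (All.universal (λ u →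
      All.map⁺ (All.map (stepping-δ u) (deltas-δ chain (Fm-characteristic as (proj₁ ∘ link))))) (states as)))

  Fm-δ : ∀ {m} (κs : Vec Formula (suc m)) → All (Fm r) κs → Fm (p ∷ r) (δ p κs)
  Fm-δ (κ ∷ [])          (h ∷ [])         = Fm-weaken κ h , here refl
  Fm-δ (κ ∷ κs@(_ ∷ _)) (h ∷ hs)         = Fm-weaken κ h , Fm-δ κs hs

  Fm-⋁ : ∀ {As} → Allᴸ (IsδFormula p r) As → Fm (p ∷ r) (⋁ As)
  Fm-⋁ []                          = tt
  Fm-⋁ ((m , κs , fm , refl) ∷ ds) = Fm-δ κs fm , Fm-⋁ ds

-- Disjunctions of δ-formulas are normal additive

module DeltaAdditivity (Γ : Pred Formula 0ℓ) {n} {p q : Var} {r : Vec Var n} (r≢ : All (λ x → x ≢ p × x ≢ q) r) where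

  open Derivations Γ

  -- A δ-formula with an arbitrary formula in place of `p`, so that inductions on `κs` avoid
  -- substitution; the coefficients are fixed by substituting for `p`, as `r` avoids `p`.
  nest : ∀ {m} → Vec Formula (suc m) → Formula → Formula
  nest (κ ∷ [])         A = κ ∧ A
  nest (κ ∷ κs@(_ ∷ _)) A = κ ∧ ◇ nest κs A

  substitute-fixed : ∀ B A → Fm r A → A [ p ↦ B ] ≡ A
  substitute-fixed B (var x) x∈      = cong (λ b → if b then B else var x) (≟-false (proj₁ (Vec.lookup r≢ x∈)))
  substitute-fixed B ⊥ᶠ      h       = refl
  substitute-fixed B ⊤ᶠ      h       = refl
  substitute-fixed B (A ∧ C) (h , k) = cong₂ _∧_ (substitute-fixed B A h) (substitute-fixed B C k)
  substitute-fixed B (A ∨ C) (h , k) = cong₂ _∨_ (substitute-fixed B A h) (substitute-fixed B C k)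
  substitute-fixed B (A ⇒ C) (h , k) = cong₂ _⇒_ (substitute-fixed B A h) (substitute-fixed B C k)
  substitute-fixed B (□ A)   h       = cong □_ (substitute-fixed B A h)
  substitute-fixed B (◇ A)   h       = cong ◇_ (substitute-fixed B A h)

  δ-nest : ∀ {m} (κs : Vec Formula (suc m)) → δ p κs ≡ nest κs (var p)
  δ-nest (κ ∷ [])         = refl
  δ-nest (κ ∷ κs@(_ ∷ _)) = cong (λ A → κ ∧ ◇ A) (δ-nest κs)

  δ-substitute : ∀ B {m} (κs : Vec Formula (suc m)) → All (Fm r) κs → δ p κs [ p ↦ B ] ≡ nest κs B
  δ-substitute B (κ ∷ [])         (h ∷ [])       = cong₂ _∧_ (substitute-fixed B κ h) (if-true (≟-true p))
  δ-substitute B (κ ∷ κs@(_ ∷ _)) (h ∷ hs@(_ ∷ _)) = cong₂ (λ C D → C ∧ ◇ D) (substitute-fixed B κ h) (δ-substitute B κs hs)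

  nest-⊥ : ∀ {m} (κs : Vec Formula (suc m)) → Λ ⊢ ¬ᶠ nest κs ⊥ᶠ
  nest-⊥ (κ ∷ [])         = tautology (⇒-intro (proj₂ ∘ ∧-elim))
  nest-⊥ (κ ∷ κs@(_ ∷ _)) = infer₂ (◇-mono (nest-⊥ κs)) ◇-⊥ λ m n → ⇒-intro λ h → ⇒-elim n (⇒-elim m (proj₂ (∧-elim h)))

  ∧-∨-distrib : ∀ a {x b c} → x ≡ b || c → a && x ≡ (a && b) || (a && c)
  ∧-∨-distrib true  eq = eq
  ∧-∨-distrib false eq = refl

  ◇-∨-↔ : Λ ⊢ ◇ (A ∨ B) ↔ ◇ A ∨ ◇ B
  ◇-∨-↔ {A} {B} = ↔-of ◇-∨ (infer₂
    (◇-mono {B = A ∨ B} (tautology (⇒-intro ∨-introˡ)))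
    (◇-mono {B = A ∨ B} (tautology (⇒-intro ∨-introʳ)))
    λ f g → ⇒-intro λ h → [ ⇒-elim f , ⇒-elim g ]′ (∨-elim h))

  nest-∨ : ∀ {m} (κs : Vec Formula (suc m)) → Λ ⊢ nest κs (A ∨ B) ↔ nest κs A ∨ nest κs B
  nest-∨ (κ ∷ [])         = tautology λ {v} → ↔-intro (∧-∨-distrib (eval v κ) refl)
  nest-∨ (κ ∷ κs@(_ ∷ _)) = infer (↔-trans (◇-cong (nest-∨ κs)) ◇-∨-↔) λ {v} h → ↔-intro (∧-∨-distrib (eval v κ) (↔-elim h))

  δ-normal-additive : ∀ {m} (κs : Vec Formula (suc m)) → All (Fm r) κs → NormalAdditive Λ p q (δ p κs)
  δ-normal-additive κs fm =
    infer (nest-⊥ κs) (λ {v} n → ∧-intro (⇒-intro λ h → ⇒-elim n (≡-subst (v ⊩_) (δ-substitute ⊥ᶠ κs fm) h)) (⇒-intro ⊥-absurd)) ,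
    infer (nest-∨ κs) λ {v} h → ↔-intro (trans (cong (eval v) (δ-substitute (var p ∨ var q) κs fm)) (trans (↔-elim h)
      (cong₂ _||_ (cong (eval v) (sym (δ-nest κs))) (cong (eval v) (sym (δ-substitute (var q) κs fm))))))

  ⋁-normal-additive : ∀ {As} → Allᴸ (IsδFormula p r) As → NormalAdditive Λ p q (⋁ As)
  ⋁-normal-additive [] = tautology (↔-intro refl) , tautology (↔-intro refl)
  ⋁-normal-additive ((m , κs , fm , refl) ∷ ds) =
    let normal , additive = δ-normal-additive κs fm
        normals , additives = ⋁-normal-additive ds in
    infer₂ normal normals (λ h k → ↔-intro (cong₂ _||_ (↔-elim h) (↔-elim k))) ,
    infer₂ additive additives λ {v} h k → ↔-intro (trans (cong₂ _||_ (↔-elim h) (↔-elim k))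
      (interchange (eval v (δ p κs)) _ _ _))
    where
    interchange : ∀ a b c d → (a || b) || (c || d) ≡ (a || c) || (b || d)
    interchange true  b     c     d = refl
    interchange false true  c     d = sym (∨-zeroʳ c)
    interchange false false c     d = refl

  -- The logic is closed under substitution, so the equivalence also holds for the instances that
  -- occur in normality and additivity.
  transfer : Λ ⊢ A ↔ B → NormalAdditive Λ p q B → NormalAdditive Λ p q A
  transfer eq (normal , additive) =
    ↔-trans (subst _ eq) normal ,
    consequence (subst _ eq ∷ additive ∷ eq ∷ subst _ eq ∷ []) λ where
      (h ∷ k ∷ e ∷ g ∷ []) → ↔-intro (trans (↔-elim h) (trans (↔-elim k) (cong₂ _||_ (sym (↔-elim e)) (sym (↔-elim g)))))

-- From additivity in the logic to δ-disjunctions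

module _ (transitive : Bool) {n} {p q : Var} (p≢q : p ≢ q) {r : Vec Var n} (r≢ : All (λ x → x ≢ p × x ≢ q) r)
  (φ : Formula) (fm : Fm (p ∷ r) φ) where

  open Semantics transitive
  open Completeness transitive (p ∷ r)
  open Marking transitive p r
  open Deltas transitive p r

  module _ (additive : Additive Λ p q φ) where

    private variable
      s t u    : Tree
      ss ts us : List Tree

    union second : Tree → Valuation
    union  t x = if does (x ≟ p) then label t p || label t q else label t x
    second t x = if does (x ≟ p) then label t q else label t x

    -- The marks of s are kept in p and those of t are put in q.
    pair  : Join s t u → Tree
    pairs : Joins ss ts us → List Tree
    pair (node {f = f} {g = g} _ js) = node (λ x → if does (x ≟ q) then g p else f x) (pairs js)
    pairs []       = []
    pairs (j ∷ js) = pair j ∷ pairs js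

    x≢q : ∀ {x} → x ∈ p ∷ r → x ≢ q
    x≢q (here refl) = p≢q
    x≢q (there x∈)  = proj₂ (Vec.lookup r≢ x∈)

    pair-≈ˡ  : (j : Join s t u) → pair j ≈ s
    pairs-≋ˡ : (js : Joins ss ts us) → pairs js ≋ ss
    pair-≈ˡ (node {f = f} {g = g} _ js) =
      node-cong (λ {x} x∈ → cong (λ b → if b then g p else f x) (≟-false (x≢q x∈))) (pairs-≋ˡ js)
    pairs-≋ˡ []       = ≋-refl
    pairs-≋ˡ (j ∷ js) = ∷-cong (pair-≈ˡ j) (pairs-≋ˡ js)

    pair-label-p : ∀ {f g : Valuation} → (if does (p ≟ q) then g p else f p) ≡ f p
    pair-label-p {f} {g} = cong (λ b → if b then g p else f p) (≟-false p≢q)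

    pair-label-q : ∀ {f g : Valuation} → (if does (q ≟ q) then g p else f q) ≡ g p
    pair-label-q = if-true (≟-true q)

    at-p : ∀ {a b : Bool} → (if does (p ≟ p) then a else b) ≡ a
    at-p = if-true (≟-true p)

    off-p,q : ∀ {x} {a b c : Bool} → x ∈ r → (if does (x ≟ p) then a else (if does (x ≟ q) then b else c)) ≡ c
    off-p,q x∈ = trans (if-false (≟-false (proj₁ (Vec.lookup r≢ x∈)))) (if-false (≟-false (proj₂ (Vec.lookup r≢ x∈))))

    pair-≈ʳ  : (j : Join s t u) → relabel second (pair j) ≈ t
    pairs-≋ʳ : (js : Joins ss ts us) → relabels second (pairs js) ≋ ts
    pair-≈ʳ (node {f = f} {g = g} (joined others marks) js) = node-cong labels (pairs-≋ʳ js)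
      where
      labels : ∀ {x} → x ∈ p ∷ r → _ ≡ g x
      labels (here refl) = trans at-p (pair-label-q {f} {g})
      labels (there x∈)  = let f≡h , g≡h = others (proj₁ (Vec.lookup r≢ x∈)) in
        trans (off-p,q x∈) (trans f≡h (sym g≡h))
    pairs-≋ʳ []       = ≋-refl
    pairs-≋ʳ (j ∷ js) = ∷-cong (pair-≈ʳ j) (pairs-≋ʳ js)

    pair-≈  : (j : Join s t u) → relabel union (pair j) ≈ u
    pairs-≋ : (js : Joins ss ts us) → relabels union (pairs js) ≋ us
    pair-≈ (node {f = f} {g = g} {h = h} (joined others marks) js) = node-cong labels (pairs-≋ js)
      where
      labels : ∀ {x} → x ∈ p ∷ r → _ ≡ h x
      labels (here refl) = trans at-p (trans (cong₂ _||_ (pair-label-p {f} {g}) (pair-label-q {f} {g})) (sym marks))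
      labels (there x∈)  = trans (off-p,q x∈) (proj₁ (others (proj₁ (Vec.lookup r≢ x∈))))
    pairs-≋ []       = ≋-refl
    pairs-≋ (j ∷ js) = ∷-cong (pair-≈ j) (pairs-≋ js)

    -- At `pair j`, the three formulas of additivity take the values of `φ` at `u`, `s` and `t`: `φ`
    -- does not mention `q`, and the two substitutions amount to relabelling by `union` and by
    -- `second`.
    sat-join : Join s t u → sat φ u ≡ sat φ s || sat φ t
    sat-join {s} {t} {u} j = trans (sym (sat-≡ (pair-≈ j) φ fm)) (trans (sym (sat-substitute union _ sat-union φ w))
      (trans (↔-sat (sound additive w)) (cong₂ _||_ (sat-≡ (pair-≈ˡ j) φ fm)
        (trans (sat-substitute second _ sat-second φ w) (sat-≡ (pair-≈ʳ j) φ fm)))))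
      where
      w : Tree
      w = pair j
      ↔-sat : ∀ {A B} → w ⊨ A ↔ B → sat A w ≡ sat B w
      ↔-sat {A} {B} h = trans (sym (eval-truth w A)) (trans (↔-elim h) (eval-truth w B))
      sat-union : ∀ t x → sat (if does (x ≟ p) then var p ∨ var q else var x) t ≡ union t x
      sat-union t x = if-float (λ A → sat A t) (does (x ≟ p))
      sat-second : ∀ t x → sat (if does (x ≟ p) then var q else var x) t ≡ second t x
      sat-second t x = if-float (λ A → sat A t) (does (x ≟ p))

  δ-disjunction : NormalAdditive Λ p q φ → ∃[ ψ ] (IsδDisjunction p r ψ × Equivalent Λ φ ψ)
  δ-disjunction (normal , additive) = conclude (true-or-false transitive)
    where
    sat-normal : ∀ t → sat φ (erase t) ≡ false
    sat-normal t = trans (sym (sat-erase φ t)) (trans (sym (eval-truth t (φ [ p ↦ ⊥ᶠ ]))) (↔-elim (sound normal t)))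

    open Splitting φ sat-normal (sat-join additive) fm

    φᶜ : Core
    φᶜ = core φ

    args : List Core
    args = modals φᶜ

    over : Over (p ∷ r) args φᶜ
    over = Over-modals (p ∷ r) φᶜ (Fm-core φ fm) id

    sat-core : ∀ t → sat φ t ≡ sat ⌜ φᶜ ⌝ t
    sat-core t = trans (sym (eval-truth t φ)) (trans (↔-elim (sound (core-↔ φ) t)) (eval-truth t ⌜ φᶜ ⌝))

    -- Only the way in which a single mark gets expressed differs between the logics; validity on
    -- all trees then becomes provable equivalence by completeness.
    from-chain : ∀ {css} → Chain args css → (∀ {s t} → Single t s → sat ⌜ φᶜ ⌝ s ≡ true → Expressed args css φᶜ t) →
                 ∃[ ψ ] (IsδDisjunction p r ψ × Equivalent Λ φ ψ)
    from-chain {css} chain express = ⋁ ds , (ds , ds-δ , refl) , complete ((fm , Fm-⋁ ds-δ) , (Fm-⋁ ds-δ , fm)) valid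
      where
      ds : List Formula
      ds = deltas args css φᶜ
      ds-δ : Allᴸ (IsδFormula p r) ds
      ds-δ = deltas-δ chain (Fm-core φ fm)
      valid : ∀ t → t ⊨ φ ↔ ⋁ ds
      valid t = ∧-intro
        (⇒-intro λ h → let s , single , k = single-complete (⊨⇒sat h)
                           d , d∈ , l = express single (trans (sym (sat-core s)) k) in ⋁⁺ d∈ (sat⇒⊨ l))
        (⇒-intro λ h → let d , d∈ , l = ⋁⁻ ds h
                           s , single , k = expressed-sound chain over (d , d∈ , ⊨⇒sat l) in
                       sat⇒⊨ (single-sound single (trans (sat-core s) k)))

    conclude : transitive ≡ true ⊎ transitive ≡ false → ∃[ ψ ] (IsδDisjunction p r ψ × Equivalent Λ φ ψ)
    conclude (inj₁ GL) = from-chain (chain (suc (length args))) (expressed-closed GL closed over)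
      where
      closed : args ↝ args
      closed = closed-modals φᶜ (Fm-core φ fm)
      chain : ∀ k → Chain args (replicate k args)
      chain zero    = [-] λ K → ⊥-elim (true≢false GL K)
      chain (suc k) = closed ∷ chain k
    conclude (inj₂ K) with chain-exists K (suc (depth φᶜ)) args
      (λ c∈ → m≤n⇒m≤1+n (modals-depth φᶜ c∈)) (modals-Fm (p ∷ r) φᶜ (Fm-core φ fm))
    ... | css , chain = from-chain chain λ {s} {t} single h →
      -- An invisible mark would make `φ` true on an erased tree, contrary to normality.
      [ id , (λ k → ⊥-elim (true≢false (trans (sat-core (erase t)) k) (sat-normal t))) ]′
        (expressed-or-invisible K chain over single h)

  normal-additive-⇔ : NormalAdditive Λ p q φ ⇔ (∃[ ψ ] (IsδDisjunction p r ψ × Equivalent Λ φ ψ))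
  normal-additive-⇔ = mk⇔ δ-disjunction λ { (_ , (ψs , ds , refl) , eq) → transfer eq (⋁-normal-additive ds) }
    where open DeltaAdditivity (base transitive) r≢

corollary5p7 : (Λ : Logic) → Λ ≡ K ⊎ Λ ≡ GL →
    (p q : Var) → p ≢ q →
    (n : ℕ) (r : Vec Var n) → All (λ x → x ≢ p × x ≢ q) r →
    (φ : Formula) → Fm (p ∷ r) φ →
    NormalAdditive Λ p q φ ⇔ (∃[ ψ ] (IsδDisjunction p r ψ × Equivalent Λ φ ψ))
corollary5p7 _ (inj₁ refl) p q p≢q n r r≢ φ fm = normal-additive-⇔ false p≢q r≢ φ fm
corollary5p7 _ (inj₂ refl) p q p≢q n r r≢ φ fm = normal-additive-⇔ true p≢q r≢ φ fm
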